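{- For $b\geq0$, $k\geq1$, $\ell_1,\ldots,\ell_k\geq b$ and $f(r)$ any formal power series with $f'(0)\neq0$, $$\frac{\partial^kf(\hat R^{(b)})}{\partial\hat x_{\ell_1}\cdots\partial\hat x_{\ell_k}}(0,0,\ldots)=k!\,[z^k]\int_0^{J^{ -1}(b;z)}\mathrm dr\,f'(r)\prod_{i=1}^kI(b,\ell_i;r)$$ is a polynomial in $b,\ell_1^2,\ldots,\ell_k^2$ that is symmetric and of degree $k-1$ in $\ell_1^2,\ldots,\ell_k^2$.
   Context: Define the formal power series in $r$ $$I(b,\ell;r)=\sum_{p=0}^\infty\frac{r^p}{(p!)^2}\prod_{m=0}^{p-1}(\ell^2-(b-m)^2),\qquad J(b;r)=\sum_{p=1}^\infty\frac{(-1)^{p+1}r^p}{p!(p-1)!}\prod_{m=0}^{p-2}(b-m)(b-m-1),$$ and let $z\mapsto J^{ -1}(b;z)=z+\cdots$ be the compositional inverse of $r\mapsto J(b;r)=r+\cdots$. $\hat R^{(b)}(\hat x_b,\hat x_{b+1},\ldots)$ is the unique formal power series with zero constant term such that $J(b;\hat R^{(b)})-\sum_{\ell=b}^\infty I(b,\ell;\hat R^{(b)})\,\hat x_\ell=0$. $[z^k]$ denotes extraction of the coefficient of $z^k$. The numbers $b,\ell_1,\ldots,\ell_k$ are integers. -}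

module Defs where

open import Level using (_⊔_)
open import Algebra.Apartness.Bundles using (HeytingCommutativeRing; HeytingField)
open import Algebra.Bundles using (CommutativeRing; RawSemiring; Semiring)
import Algebra.Definitions.RawSemiring as RawSemiringDefinitions
open import Data.Fin.Base using (toℕ)
open import Data.Fin.Permutation using (Permutation′; _⟨$⟩ʳ_)
open import Data.List.Base as List using (List; []; _∷_)
open import Data.Nat.Base as ℕ using (ℕ; zero; suc; _∸_; _!; NonZero)
import Data.Nat.ListAction as ListAction
open import Data.Nat.Properties using (_!≢0)
open import Data.Product.Base using (_×_; ∃-syntax; proj₁)
open import Data.Vec.Base as Vec using (Vec; []; _∷_)
open import Relation.Binary.PropositionalEquality.Core using (_≡_)

rawSemiring : ∀ {c ℓ₁ ℓ₂} → HeytingField c ℓ₁ ℓ₂ → RawSemiring c ℓ₁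
rawSemiring K =
  Semiring.rawSemiring (CommutativeRing.semiring
    (HeytingCommutativeRing.commutativeRing (HeytingField.heytingCommutativeRing K)))

CharacteristicZero : ∀ {c ℓ₁ ℓ₂} → HeytingField c ℓ₁ ℓ₂ → Set ℓ₂
CharacteristicZero K = ∀ n → .{{NonZero n}} → (n · 1#) # 0#
  where
  open HeytingField K
  open RawSemiringDefinitions (rawSemiring K) renaming (_×_ to _·_)

module Series {c ℓ₁ ℓ₂} (K : HeytingField c ℓ₁ ℓ₂) (char0 : CharacteristicZero K) where

  open HeytingField K public
    using (Carrier; _≈_; _#_; _+_; _*_; -_; _-_; 0#; 1#; #⇒invertible)
  open RawSemiringDefinitions (rawSemiring K) public
    using (_^_; sum; product) renaming (_×_ to infixr 8 _·_)

  fromℕ : ℕ → Carrier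
  fromℕ n = n · 1#

  recip : (n : ℕ) → .{{NonZero n}} → Carrier
  recip n = proj₁ (#⇒invertible (char0 n))

  1/_! : ℕ → Carrier
  1/ n ! = recip (n !) {{n !≢0}}

  ∑< ∏< : ℕ → (ℕ → Carrier) → Carrier
  ∑< n t = sum {n} (λ i → t (toℕ i))
  ∏< n t = product {n} (λ i → t (toℕ i))

  ----------------------------------------------------------------------
  -- K[[r]]: the value at n is the coefficient of rⁿ.

  PowerSeries : Set c
  PowerSeries = ℕ → Carrier

  one : PowerSeries
  one zero    = 1#
  one (suc _) = 0#

  var : PowerSeries
  var (suc zero) = 1#
  var _          = 0#

  infixl 7 _⊛_
  _⊛_ : PowerSeries → PowerSeries → PowerSeries
  (f ⊛ g) n = ∑< (suc n) λ i → f i * g (n ∸ i)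

  pow : PowerSeries → ℕ → PowerSeries
  pow f zero    = one
  pow f (suc p) = f ⊛ pow f p

  -- f(g(z)), for g with zero constant term: then gᵖ has no term of order
  -- below p, so the sum over p stops at n.
  infixr 9 _⊚_
  _⊚_ : PowerSeries → PowerSeries → PowerSeries
  (f ⊚ g) n = ∑< (suc n) λ p → f p * pow g p n

  deriv : PowerSeries → PowerSeries
  deriv f n = suc n · f (suc n)

  -- r ↦ ∫₀ʳ f
  integral : PowerSeries → PowerSeries
  integral f zero    = 0#
  integral f (suc n) = recip (suc n) * f n

  record IsCompositionalInverse (f g : PowerSeries) : Set ℓ₁ where
    field
      zeroConstantTerm : g 0 ≈ 0#
      inverseʳ         : ∀ n → (f ⊚ g) n ≈ var n
      inverseˡ         : ∀ n → (g ⊚ f) n ≈ var n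

  I : (b ℓ : ℕ) → PowerSeries
  I b ℓ p = (1/ p ! * 1/ p !) *
            ∏< p λ m → fromℕ ℓ ^ 2 - (fromℕ b - fromℕ m) ^ 2

  -- The clause for suc q is the coefficient with p = q + 1.
  J : (b : ℕ) → PowerSeries
  J b zero    = 0#
  J b (suc q) = ((- 1#) ^ suc (suc q) * (1/ suc q ! * 1/ q !)) *
                ∏< q λ m → (fromℕ b - fromℕ m) * (fromℕ b - fromℕ m - 1#)

  ∏I : ∀ {k} (b : ℕ) → Vec ℕ k → PowerSeries
  ∏I b ℓs = Vec.foldr′ _⊛_ one (Vec.map (I b) ℓs)

  ----------------------------------------------------------------------
  -- K[[x₀, x₁, x₂, …]]: the list a₀ ∷ a₁ ∷ … ∷ aₙ ∷ [] stands for the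
  -- monomial x₀^a₀ x₁^a₁ ⋯ xₙ^aₙ, so lists that differ by trailing zeros
  -- stand for the same monomial.  A coefficient function is a power series
  -- when it respects this identification.

  Monomial : Set
  Monomial = List ℕ

  exponent : Monomial → ℕ → ℕ
  exponent []      _       = 0
  exponent (a ∷ α) zero    = a
  exponent (a ∷ α) (suc j) = exponent α j

  totalDegree : Monomial → ℕ
  totalDegree = ListAction.sum

  MvSeries : Set c
  MvSeries = Monomial → Carrier

  IsMvSeries : MvSeries → Set ℓ₁
  IsMvSeries F = ∀ α β → (∀ j → exponent α j ≡ exponent β j) → F α ≈ F β

  mvOne : MvSeries
  mvOne []          = 1#
  mvOne (zero  ∷ α) = mvOne α
  mvOne (suc _ ∷ α) = 0#

  mvVar : ℕ → MvSeries
  mvVar zero    (suc zero ∷ α) = mvOne α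
  mvVar (suc j) (zero ∷ α)     = mvVar j α
  mvVar _       _              = 0#

  infixl 7 _⊠_
  _⊠_ : MvSeries → MvSeries → MvSeries
  (F ⊠ G) []      = F [] * G []
  (F ⊠ G) (a ∷ α) = ∑< (suc a) λ i →
    ((λ β → F (i ∷ β)) ⊠ (λ β → G ((a ∸ i) ∷ β))) α

  mvPow : MvSeries → ℕ → MvSeries
  mvPow F zero    = mvOne
  mvPow F (suc p) = F ⊠ mvPow F p

  -- f(F), for F with zero constant term: Fᵖ has no term of total degree
  -- below p.
  infix 9 _⟦_⟧
  _⟦_⟧ : PowerSeries → MvSeries → MvSeries
  (f ⟦ F ⟧) α = ∑< (suc (totalDegree α)) λ p → f p * mvPow F p α

  -- ∑_{j ≥ 0} Gⱼ xⱼ: a monomial written with n exponents does not involve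
  -- xⱼ for j ≥ n.
  ∑x : (ℕ → MvSeries) → MvSeries
  ∑x G α = ∑< (List.length α) λ j → (G j ⊠ mvVar j) α

  timesVar : ℕ → Monomial → Monomial
  timesVar zero    []      = 1 ∷ []
  timesVar zero    (a ∷ α) = suc a ∷ α
  timesVar (suc j) []      = 0 ∷ timesVar j []
  timesVar (suc j) (a ∷ α) = a ∷ timesVar j α

  ∂ : ℕ → MvSeries → MvSeries
  ∂ j F α = suc (exponent α j) · F (timesVar j α)

  atOrigin : MvSeries → Carrier
  atOrigin F = F []

  -- For series in x̂_b, x̂_{b+1}, …, the variable x̂_ℓ (ℓ ≥ b) is xⱼ with
  -- j = ℓ − b.

  ∂x̂ : ∀ {k} (b : ℕ) → Vec ℕ k → MvSeries → MvSeries
  ∂x̂ b ℓs F = Vec.foldr′ (λ ℓ → ∂ (ℓ ∸ b)) F ℓs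

  record IsR̂ (b : ℕ) (R : MvSeries) : Set ℓ₁ where
    field
      isMvSeries       : IsMvSeries R
      zeroConstantTerm : R [] ≈ 0#
      equation         : ∀ α →
        (J b ⟦ R ⟧) α - ∑x (λ j → I b (b ℕ.+ j) ⟦ R ⟧) α ≈ 0#

  ----------------------------------------------------------------------
  -- K[t₁, …, tₙ]

  record Polynomial (n : ℕ) : Set (c ⊔ ℓ₁) where
    field
      coeff   : Vec ℕ n → Carrier
      bound   : ℕ
      bounded : ∀ α → bound ℕ.< Vec.sum α → coeff α ≈ 0#

  open Polynomial public

  -- The sum of the terms whose exponents are all at most N.
  evalUpTo : ∀ {n} → ℕ → (Vec ℕ n → Carrier) → Vec Carrier n → Carrier
  evalUpTo N a []       = a []
  evalUpTo N a (t ∷ ts) =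
    ∑< (suc N) λ i → evalUpTo N (λ α → a (i ∷ α)) ts * t ^ i

  eval : ∀ {n} → Polynomial n → Vec Carrier n → Carrier
  eval P = evalUpTo (bound P) (coeff P)

  -- A polynomial in b, y₁, …, y_k has b as its first variable.

  SymmetricInY : ∀ {k} → Polynomial (suc k) → Set ℓ₁
  SymmetricInY {k} P = ∀ (π : Permutation′ k) i (α : Vec ℕ k) →
    coeff P (i ∷ Vec.tabulate (λ j → Vec.lookup α (π ⟨$⟩ʳ j))) ≈ coeff P (i ∷ α)

  DegreeInY : ∀ {k} → Polynomial (suc k) → ℕ → Set (ℓ₁ ⊔ ℓ₂)
  DegreeInY {k} P d =
    (∀ i (α : Vec ℕ k) → d ℕ.< Vec.sum α → coeff P (i ∷ α) ≈ 0#) ×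
    (∃[ i ] ∃[ α ] (Vec.sum {k} α ≡ d × coeff P (i ∷ α) # 0#))

{-# OPTIONS --safe #-}
module Submission where

-- Since I(b,b;r) = 1, the variable x̂_b enters the equation for R̂ purely
-- additively.  Differentiating the equation gives ∂_ℓ R̂ = I(b,ℓ;R̂) ∂_b R̂, hence
-- ∂_ℓ h(R̂) = ∂_b (∫ h′ I(b,ℓ;·))(R̂) for every series h.  Iterating turns
-- ∂_{ℓ₁} ⋯ ∂_{ℓ_k} f(R̂) into ∂_b^k (∫ f′ ∏ I(b,ℓᵢ;·))(R̂), and on the x̂_b axis
-- R̂ is J⁻¹(b; x̂_b).
--
-- For polynomiality, expand I(b,ℓ;r) in powers of ℓ² with coefficients
-- polynomial in b; the term ℓ²ᵃ only occurs at order rᵃ and above.  The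
-- coefficient of each monomial in the ℓᵢ² is then a polynomial function of
-- b ∈ ℕ of bounded degree, and in characteristic zero such a function determines
-- its coefficients.  So symmetry, and vanishing above degree k − 1, can be
-- checked on values.

open import Defs
open import Algebra.Apartness.Bundles using (HeytingCommutativeRing; HeytingField)
import Algebra.Apartness.Properties.HeytingCommutativeRing as HeytingProperties
open import Algebra.Bundles using (CommutativeMonoid; CommutativeRing; CommutativeSemiring)
import Algebra.Properties.CommutativeMonoid.Mult as CommutativeMonoidMult
import Algebra.Properties.CommutativeMonoid.Sum as CommutativeMonoidSum
import Algebra.Properties.Group as GroupProperties
import Algebra.Properties.Ring as RingProperties
import Algebra.Properties.Semiring.Mult as SemiringMult
import Algebra.Solver.Ring.NaturalCoefficients.Default as NaturalCoefficients
open import Data.Empty using (⊥-elim)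
open import Data.Fin.Base as Fin using (Fin)
open import Data.Fin.Permutation using (Permutation′; _⟨$⟩ʳ_)
open import Data.List.Base using ([]; _∷_; length)
open import Data.Nat.Base as ℕ using (ℕ; zero; suc; _≤_; _<_; z≤n; s≤s; _∸_; _!; NonZero)
import Data.Nat.Properties as ℕₚ
open import Data.Nat.Solver using (module +-*-Solver)
open import Data.Product.Base using (_×_; _,_; ∃-syntax; proj₁; proj₂)
open import Data.Sum.Base using (inj₁; inj₂)
open import Data.Vec.Base as Vec using (Vec; []; _∷_; map)
import Data.Vec.Properties as Vecₚ
open import Data.Vec.Relation.Unary.All using (All; []; _∷_)
open import Level using (_⊔_)
open import Relation.Binary.PropositionalEquality.Core as ≡ using (_≡_; _≢_)
import Relation.Binary.Reasoning.Setoid as SetoidReasoning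

-- Three obstacles shape the construction. The series `J⁻¹` is given separately for each b, so
-- nothing can be read off about how it varies with b. It is replaced by explicit iterates that
-- agree with every right inverse of `J` to the order that matters and whose coefficients are
-- visibly polynomial in b; the same comparison identifies `J⁻¹` with `R̂` on the x̂_b axis. Next,
-- `Polynomial` wants one bound for all of its infinitely many coefficients, so polynomiality in b
-- is tracked with a degree bound common to all exponent vectors of the ℓᵢ². Finally, equality in K
-- is not assumed decidable: degrees are never computed from a last nonzero coefficient, orders of
-- vanishing and list lengths stand in for them, and exactness of the degree k - 1 comes from one
-- coefficient shown to be apart from zero. It belongs to the monomial (ℓ₁²)^(k-1). There the
-- integral costs one order of r, `J⁻¹` starts with z, and the value is f′(0)/(k - 1)! for every b.

m<n∸i⇒i+m<n : ∀ i n {m} → m < n ∸ i → i ℕ.+ m < n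
m<n∸i⇒i+m<n zero    n       m< = m<
m<n∸i⇒i+m<n (suc i) (suc n) m< = s≤s (m<n∸i⇒i+m<n i n m<)

-- The head exponent `a` of a monomial splits as `i` and `a ∸ i` between two factors, and each share
-- is charged to the order of its factor. Where truncated subtraction loses something,
-- `x ≤ y + (x ∸ y)` still gives the bound.
split-< : ∀ {a i} d p n → i ≤ a → a ℕ.+ d < p ℕ.+ n → d < (p ∸ i) ℕ.+ (n ∸ (a ∸ i))
split-< {a} {i} d p n i≤a a+d<p+n = ℕₚ.+-cancelˡ-< a _ _ (begin-strict
  a ℕ.+ d                                           <⟨ a+d<p+n ⟩
  p ℕ.+ n                                           ≤⟨ ℕₚ.+-mono-≤ (ℕₚ.m≤n+m∸n p i) (ℕₚ.m≤n+m∸n n (a ∸ i)) ⟩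
  (i ℕ.+ (p ∸ i)) ℕ.+ ((a ∸ i) ℕ.+ (n ∸ (a ∸ i)))   ≡⟨ solve 4 (λ x y z w → (x :+ y) :+ (z :+ w) := (x :+ z) :+ (y :+ w))
                                                         ≡.refl i (p ∸ i) (a ∸ i) (n ∸ (a ∸ i)) ⟩
  (i ℕ.+ (a ∸ i)) ℕ.+ ((p ∸ i) ℕ.+ (n ∸ (a ∸ i)))   ≡⟨ ≡.cong (ℕ._+ ((p ∸ i) ℕ.+ (n ∸ (a ∸ i)))) (ℕₚ.m+[n∸m]≡n i≤a) ⟩
  a ℕ.+ ((p ∸ i) ℕ.+ (n ∸ (a ∸ i)))                 ∎)
  where
  open ℕₚ.≤-Reasoning
  open +-*-Solver

module Development {c ℓ₁ ℓ₂} (K : HeytingField c ℓ₁ ℓ₂) (char0 : CharacteristicZero K) where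

  open Series K char0

  ring : CommutativeRing c ℓ₁
  ring = HeytingCommutativeRing.commutativeRing (HeytingField.heytingCommutativeRing K)

  open CommutativeRing ring
    using ( setoid; refl; sym; trans; reflexive; +-cong; +-congˡ; +-congʳ; +-assoc; +-comm
          ; +-identityˡ; +-identityʳ; *-cong; *-congˡ; *-congʳ; *-assoc; *-comm
          ; *-identityˡ; *-identityʳ; zeroˡ; zeroʳ; distribˡ; distribʳ; -‿cong; -‿inverseʳ)
  open SetoidReasoning setoid
  open GroupProperties (CommutativeRing.+-group ring)
    using () renaming (∙-cancelʳ to +-cancelʳ; x∙y⁻¹≈ε⇒x≈y to x-y≈0⇒x≈y)
  open RingProperties (CommutativeRing.ring ring) using (-1*x≈-x; -‿involutive)
  open SemiringMult (CommutativeRing.semiring ring)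
    using () renaming
    ( ×-congʳ to ·-congʳ; ×-homo-1 to ·-homo-1; ×-homo-+ to ·-homo-+; ×-assocˡ to ·-assocˡ
    ; ×-comm-* to ·-comm-*; ×-assoc-* to ·-assoc-*)
  open CommutativeMonoidMult (CommutativeRing.+-commutativeMonoid ring)
    using () renaming (×-distrib-+ to ·-distrib-+)
  open HeytingProperties (HeytingField.heytingCommutativeRing K)
    using (x-0≈x; x#0y#0→xy#0; #-congʳ; invertibleʳ⇒#)
  module Solver = NaturalCoefficients (CommutativeRing.commutativeSemiring ring)

  -- Natural multiples and reciprocals of natural numbers

  m·0≈0 : ∀ m → m · 0# ≈ 0#
  m·0≈0 m = trans (·-assocˡ 0# m 0) (reflexive (≡.cong (_· 0#) (ℕₚ.*-zeroʳ m)))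

  ·-as-* : ∀ m x → m · x ≈ fromℕ m * x
  ·-as-* m x = sym (trans (·-assoc-* m 1# x) (·-congʳ m (*-identityˡ x)))

  ·-swap : ∀ m n x → m · (n · x) ≈ n · (m · x)
  ·-swap m n x = trans (·-assocˡ x m n)
    (trans (reflexive (≡.cong (_· x) (ℕₚ.*-comm m n))) (sym (·-assocˡ x n m)))

  -- The inverse supplied by `#⇒invertible` is that of the difference `fromℕ n - 0#`.
  recip-inverseˡ : ∀ n .{{_ : NonZero n}} → recip n * fromℕ n ≈ 1#
  recip-inverseˡ n = trans (*-congˡ (sym (x-0≈x (fromℕ n)))) (proj₁ (proj₂ (#⇒invertible (char0 n))))

  recip-1 : recip 1 ≈ 1#
  recip-1 = trans (sym (*-identityʳ _)) (trans (*-congˡ (sym (+-identityʳ 1#))) (recip-inverseˡ 1))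

  recip#0 : ∀ n .{{_ : NonZero n}} → recip n # 0#
  recip#0 n = invertibleʳ⇒# (fromℕ n , trans (*-congʳ (x-0≈x _)) (recip-inverseˡ n))

  fromℕ*x≈0⇒x≈0 : ∀ m .{{_ : NonZero m}} x → fromℕ m * x ≈ 0# → x ≈ 0#
  fromℕ*x≈0⇒x≈0 m x eq = begin
    x                       ≈⟨ *-identityˡ x ⟨
    1# * x                  ≈⟨ *-congʳ (recip-inverseˡ m) ⟨
    recip m * fromℕ m * x   ≈⟨ *-assoc _ _ _ ⟩
    recip m * (fromℕ m * x) ≈⟨ *-congˡ eq ⟩
    recip m * 0#            ≈⟨ zeroʳ _ ⟩
    0#                      ∎

  -- Finite sums

  ∑-cong : ∀ n {s t : ℕ → Carrier} → (∀ i → i < n → s i ≈ t i) → ∑< n s ≈ ∑< n t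
  ∑-cong zero    s≈t = refl
  ∑-cong (suc n) s≈t = +-cong (s≈t 0 (s≤s z≤n)) (∑-cong n λ i i<n → s≈t (suc i) (s≤s i<n))

  ∑-cong′ : ∀ n {s t : ℕ → Carrier} → (∀ i → s i ≈ t i) → ∑< n s ≈ ∑< n t
  ∑-cong′ n s≈t = ∑-cong n λ i _ → s≈t i

  ∑-zero : ∀ n {t : ℕ → Carrier} → (∀ i → i < n → t i ≈ 0#) → ∑< n t ≈ 0#
  ∑-zero zero    t≈0 = refl
  ∑-zero (suc n) t≈0 = trans
    (+-cong (t≈0 0 (s≤s z≤n)) (∑-zero n λ i i<n → t≈0 (suc i) (s≤s i<n))) (+-identityˡ 0#)

  ∑-distrib-+ : ∀ n (s t : ℕ → Carrier) → ∑< n (λ i → s i + t i) ≈ ∑< n s + ∑< n t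
  ∑-distrib-+ zero    s t = sym (+-identityˡ 0#)
  ∑-distrib-+ (suc n) s t = trans (+-congˡ (∑-distrib-+ n (λ i → s (suc i)) (λ i → t (suc i))))
    (Solver.solve 4 (λ a b c d → (a :+ b) :+ (c :+ d) := (a :+ c) :+ (b :+ d)) refl _ _ _ _)
    where open Solver using (_:+_; _:=_)

  ∑-distribˡ-* : ∀ n x (t : ℕ → Carrier) → x * ∑< n t ≈ ∑< n (λ i → x * t i)
  ∑-distribˡ-* zero    x t = zeroʳ x
  ∑-distribˡ-* (suc n) x t =
    trans (distribˡ x _ _) (+-congˡ (∑-distribˡ-* n x (λ i → t (suc i))))

  ∑-distribʳ-* : ∀ n x (t : ℕ → Carrier) → ∑< n t * x ≈ ∑< n (λ i → t i * x)
  ∑-distribʳ-* zero    x t = zeroˡ x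
  ∑-distribʳ-* (suc n) x t =
    trans (distribʳ x _ _) (+-congˡ (∑-distribʳ-* n x (λ i → t (suc i))))

  ∑-distrib-· : ∀ n m (t : ℕ → Carrier) → m · ∑< n t ≈ ∑< n (λ i → m · t i)
  ∑-distrib-· zero    m t = m·0≈0 m
  ∑-distrib-· (suc n) m t =
    trans (·-distrib-+ _ _ m) (+-congˡ (∑-distrib-· n m (λ i → t (suc i))))

  ∑-swap : ∀ m n (t : ℕ → ℕ → Carrier) →
           ∑< m (λ i → ∑< n (λ j → t i j)) ≈ ∑< n (λ j → ∑< m (λ i → t i j))
  ∑-swap zero    n t = sym (∑-zero n λ _ _ → refl)
  ∑-swap (suc m) n t = trans (+-congˡ (∑-swap m n (λ i → t (suc i))))
    (sym (∑-distrib-+ n (t 0) (λ j → ∑< m (λ i → t (suc i) j))))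

  ∑-snoc : ∀ n (t : ℕ → Carrier) → ∑< (suc n) t ≈ ∑< n t + t n
  ∑-snoc zero    t = +-comm (t 0) 0#
  ∑-snoc (suc n) t = trans (+-congˡ (∑-snoc n (λ i → t (suc i)))) (sym (+-assoc _ _ _))

  ∑-extend : ∀ {m n} (t : ℕ → Carrier) → m ≤ n → (∀ i → m ≤ i → t i ≈ 0#) → ∑< n t ≈ ∑< m t
  ∑-extend {n = n} t z≤n t≈0 = ∑-zero n λ i _ → t≈0 i z≤n
  ∑-extend t (s≤s m≤n) t≈0 = +-congˡ (∑-extend (λ i → t (suc i)) m≤n λ i m≤i → t≈0 (suc i) (s≤s m≤i))

  -- `T` takes both indices separately, so that reversal never has to rewrite `n ∸ (n ∸ i)` to `i`.
  ∑-reverse : ∀ n (T : ℕ → ℕ → Carrier) →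
              ∑< (suc n) (λ i → T i (n ∸ i)) ≈ ∑< (suc n) (λ i → T (n ∸ i) i)
  ∑-reverse zero    T = refl
  ∑-reverse (suc n) T = begin
    T 0 (suc n) + ∑< (suc n) (λ i → T (suc i) (n ∸ i))
      ≈⟨ +-congˡ (∑-reverse n (λ i → T (suc i))) ⟩
    T 0 (suc n) + ∑< (suc n) (λ i → T (suc (n ∸ i)) i)
      ≈⟨ +-comm _ _ ⟩
    ∑< (suc n) (λ i → T (suc (n ∸ i)) i) + T 0 (suc n)
      ≈⟨ +-cong (∑-cong (suc n) λ { i (s≤s i≤n) → reflexive (≡.cong (λ m → T m i) (≡.sym (ℕₚ.+-∸-assoc 1 i≤n))) })
                (reflexive (≡.cong (λ m → T m (suc n)) (≡.sym (ℕₚ.n∸n≡0 (suc n))))) ⟩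
    ∑< (suc n) (λ i → T (suc n ∸ i) i) + T (suc n ∸ suc n) (suc n)
      ≈⟨ ∑-snoc (suc n) (λ i → T (suc n ∸ i) i) ⟨
    ∑< (suc (suc n)) (λ i → T (suc n ∸ i) i) ∎

  -- Both sides run over the triples of naturals with sum `n`; the induction splits off those whose
  -- first entry is 0. This is the reindexing behind associativity of convolution.
  ∑-triangle : ∀ n (T : ℕ → ℕ → ℕ → Carrier) →
    ∑< (suc n) (λ i → ∑< (suc i) (λ j → T j (i ∸ j) (n ∸ i))) ≈
    ∑< (suc n) (λ i → ∑< (suc (n ∸ i)) (λ j → T i j (n ∸ i ∸ j)))
  ∑-triangle zero    T = refl
  ∑-triangle (suc n) T = begin
    (T 0 0 (suc n) + 0#) +
    ∑< (suc n) (λ i → T 0 (suc i) (n ∸ i) + ∑< (suc i) (λ j → T (suc j) (i ∸ j) (n ∸ i)))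
      ≈⟨ +-cong (+-identityʳ _) (∑-distrib-+ (suc n) (λ i → T 0 (suc i) (n ∸ i))
           (λ i → ∑< (suc i) (λ j → T (suc j) (i ∸ j) (n ∸ i)))) ⟩
    T 0 0 (suc n) + (∑< (suc n) (λ i → T 0 (suc i) (n ∸ i)) +
    ∑< (suc n) (λ i → ∑< (suc i) (λ j → T (suc j) (i ∸ j) (n ∸ i))))
      ≈⟨ +-assoc _ _ _ ⟨
    (T 0 0 (suc n) + ∑< (suc n) (λ i → T 0 (suc i) (n ∸ i))) +
    ∑< (suc n) (λ i → ∑< (suc i) (λ j → T (suc j) (i ∸ j) (n ∸ i)))
      ≈⟨ +-congˡ (∑-triangle n (λ i → T (suc i))) ⟩
    ∑< (suc (suc n)) (λ i → ∑< (suc (suc n ∸ i)) (λ j → T i j (suc n ∸ i ∸ j))) ∎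

  -- The ring of series in several variables

  infix 4 _≋_
  _≋_ : MvSeries → MvSeries → Set ℓ₁
  F ≋ G = ∀ α → F α ≈ G α

  infixl 6 _⊞_
  _⊞_ : MvSeries → MvSeries → MvSeries
  (F ⊞ G) α = F α + G α

  mvZero : MvSeries
  mvZero _ = 0#

  slice : ℕ → MvSeries → MvSeries
  slice i F β = F (i ∷ β)

  -- A product at `α` reads its factors only at lists as long as `α`. The sharper form is needed
  -- because `∑x` takes its number of summands from the length of the list.
  ⊠-cong-length : ∀ {F F′ G G′} α →
    (∀ β → length β ≡ length α → F β ≈ F′ β) →
    (∀ β → length β ≡ length α → G β ≈ G′ β) →
    (F ⊠ G) α ≈ (F′ ⊠ G′) α
  ⊠-cong-length []      F≈ G≈ = *-cong (F≈ [] ≡.refl) (G≈ [] ≡.refl)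
  ⊠-cong-length (a ∷ α) F≈ G≈ = ∑-cong′ (suc a) λ i → ⊠-cong-length α
    (λ β eq → F≈ (i ∷ β) (≡.cong suc eq)) (λ β eq → G≈ ((a ∸ i) ∷ β) (≡.cong suc eq))

  ⊠-cong : ∀ {F F′ G G′} → F ≋ F′ → G ≋ G′ → F ⊠ G ≋ F′ ⊠ G′
  ⊠-cong F≈ G≈ α = ⊠-cong-length α (λ β _ → F≈ β) (λ β _ → G≈ β)

  ⊠-zeroˡ : ∀ F → mvZero ⊠ F ≋ mvZero
  ⊠-zeroˡ F []      = zeroˡ _
  ⊠-zeroˡ F (a ∷ α) = ∑-zero (suc a) λ i _ → ⊠-zeroˡ (slice (a ∸ i) F) α

  ⊠-distribʳ : ∀ F G H → (G ⊞ H) ⊠ F ≋ G ⊠ F ⊞ H ⊠ F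
  ⊠-distribʳ F G H []      = distribʳ _ _ _
  ⊠-distribʳ F G H (a ∷ α) = trans
    (∑-cong′ (suc a) λ i → ⊠-distribʳ (slice (a ∸ i) F) (slice i G) (slice i H) α)
    (∑-distrib-+ (suc a) (λ i → (slice i G ⊠ slice (a ∸ i) F) α) (λ i → (slice i H ⊠ slice (a ∸ i) F) α))

  ⊠-comm : ∀ F G → F ⊠ G ≋ G ⊠ F
  ⊠-comm F G []      = *-comm _ _
  ⊠-comm F G (a ∷ α) = trans
    (∑-cong′ (suc a) λ i → ⊠-comm (slice i F) (slice (a ∸ i) G) α)
    (sym (∑-reverse a λ i j → (slice i G ⊠ slice j F) α))

  ⊠-distribˡ : ∀ F G H → F ⊠ (G ⊞ H) ≋ F ⊠ G ⊞ F ⊠ H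
  ⊠-distribˡ F G H α = trans (⊠-comm F (G ⊞ H) α)
    (trans (⊠-distribʳ F G H α) (+-cong (⊠-comm G F α) (⊠-comm H F α)))

  ∑ₘ : ℕ → (ℕ → MvSeries) → MvSeries
  ∑ₘ n G α = ∑< n λ j → G j α

  ⊠-∑ʳ : ∀ n F (G : ℕ → MvSeries) → ∑ₘ n G ⊠ F ≋ ∑ₘ n λ j → G j ⊠ F
  ⊠-∑ʳ zero    F G α = ⊠-zeroˡ F α
  ⊠-∑ʳ (suc n) F G α = trans (⊠-distribʳ F (G 0) (∑ₘ n λ j → G (suc j)) α)
    (+-congˡ (⊠-∑ʳ n F (λ j → G (suc j)) α))

  ⊠-∑ˡ : ∀ n F (G : ℕ → MvSeries) → F ⊠ ∑ₘ n G ≋ ∑ₘ n λ j → F ⊠ G j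
  ⊠-∑ˡ n F G α = trans (⊠-comm F (∑ₘ n G) α)
    (trans (⊠-∑ʳ n F G α) (∑-cong′ n λ j → ⊠-comm (G j) F α))

  ⊠-assoc : ∀ F G H → (F ⊠ G) ⊠ H ≋ F ⊠ (G ⊠ H)
  ⊠-assoc F G H []      = *-assoc _ _ _
  ⊠-assoc F G H (a ∷ α) = begin
    ∑< (suc a) (λ i → (slice i (F ⊠ G) ⊠ slice (a ∸ i) H) α)
      ≈⟨ ∑-cong′ (suc a) (λ i → ⊠-∑ʳ (suc i) (slice (a ∸ i) H) (λ j → slice j F ⊠ slice (i ∸ j) G) α) ⟩
    ∑< (suc a) (λ i → ∑< (suc i) λ j → ((slice j F ⊠ slice (i ∸ j) G) ⊠ slice (a ∸ i) H) α)
      ≈⟨ ∑-triangle a (λ i j k → ((slice i F ⊠ slice j G) ⊠ slice k H) α) ⟩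
    ∑< (suc a) (λ i → ∑< (suc (a ∸ i)) λ j → ((slice i F ⊠ slice j G) ⊠ slice (a ∸ i ∸ j) H) α)
      ≈⟨ ∑-cong′ (suc a) (λ i → ∑-cong′ (suc (a ∸ i)) λ j →
           ⊠-assoc (slice i F) (slice j G) (slice (a ∸ i ∸ j) H) α) ⟩
    ∑< (suc a) (λ i → ∑< (suc (a ∸ i)) λ j → (slice i F ⊠ (slice j G ⊠ slice (a ∸ i ∸ j) H)) α)
      ≈⟨ ∑-cong′ (suc a) (λ i → ⊠-∑ˡ (suc (a ∸ i)) (slice i F) (λ j → slice j G ⊠ slice (a ∸ i ∸ j) H) α) ⟨
    ∑< (suc a) (λ i → (slice i F ⊠ slice (a ∸ i) (G ⊠ H)) α) ∎

  ⊠-identityˡ : ∀ F → mvOne ⊠ F ≋ F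
  ⊠-identityˡ F []      = *-identityˡ _
  ⊠-identityˡ F (a ∷ α) = trans
    (+-cong (⊠-identityˡ (slice a F) α) (∑-zero a λ i _ → ⊠-zeroˡ (slice (a ∸ suc i) F) α))
    (+-identityʳ _)

  ⊠-scaleˡ : ∀ x F G → (λ β → x * F β) ⊠ G ≋ λ β → x * (F ⊠ G) β
  ⊠-scaleˡ x F G []      = *-assoc _ _ _
  ⊠-scaleˡ x F G (a ∷ α) = trans
    (∑-cong′ (suc a) λ i → ⊠-scaleˡ x (slice i F) (slice (a ∸ i) G) α)
    (sym (∑-distribˡ-* (suc a) x λ i → (slice i F ⊠ slice (a ∸ i) G) α))

  ⊠-scaleʳ : ∀ x F G → F ⊠ (λ β → x * G β) ≋ λ β → x * (F ⊠ G) β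
  ⊠-scaleʳ x F G α = trans (⊠-comm F _ α)
    (trans (⊠-scaleˡ x G F α) (*-congˡ (⊠-comm G F α)))

  mvCommutativeSemiring : CommutativeSemiring c ℓ₁
  mvCommutativeSemiring = record
    { Carrier = MvSeries
    ; _≈_ = _≋_
    ; _+_ = _⊞_
    ; _*_ = _⊠_
    ; 0# = mvZero
    ; 1# = mvOne
    ; isCommutativeSemiring = record
      { isSemiring = record
        { isSemiringWithoutAnnihilatingZero = record
          { +-isCommutativeMonoid = record
            { isMonoid = record
              { isSemigroup = record
                { isMagma = record
                  { isEquivalence = record
                    { refl  = λ _ → refl
                    ; sym   = λ F≋G α → sym (F≋G α)
                    ; trans = λ F≋G G≋H α → trans (F≋G α) (G≋H α)
                    }
                  ; ∙-cong = λ F≋ G≋ α → +-cong (F≋ α) (G≋ α)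
                  }
                ; assoc = λ _ _ _ _ → +-assoc _ _ _
                }
              ; identity = (λ _ _ → +-identityˡ _) , (λ _ _ → +-identityʳ _)
              }
            ; comm = λ _ _ _ → +-comm _ _
            }
          ; *-cong = ⊠-cong
          ; *-assoc = ⊠-assoc
          ; *-identity = ⊠-identityˡ , λ F α → trans (⊠-comm F mvOne α) (⊠-identityˡ F α)
          ; distrib = ⊠-distribˡ , ⊠-distribʳ
          }
        ; zero = ⊠-zeroˡ , λ F α → trans (⊠-comm F mvZero α) (⊠-zeroˡ F α)
        }
      ; *-comm = ⊠-comm
      }
    }

  module MvSolver = NaturalCoefficients mvCommutativeSemiring
  module Mv = CommutativeSemiring mvCommutativeSemiring

  -- Order of vanishing at the origin

  OrderAtLeast : ℕ → MvSeries → Set ℓ₁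
  OrderAtLeast p F = ∀ α → totalDegree α < p → F α ≈ 0#

  AgreeBelow : ℕ → MvSeries → MvSeries → Set ℓ₁
  AgreeBelow N F G = ∀ α → totalDegree α < N → F α ≈ G α

  -- If F - G has order at least `N` and R has order at least `p`, then R(F - G) has order at least
  -- `p + N`; stated through agreement, it involves no subtraction. With `mvZero` for `G` it says
  -- that orders add.
  ⊠-agreeBelow : ∀ p N {R F G} → OrderAtLeast p R → AgreeBelow N F G →
                 AgreeBelow (p ℕ.+ N) (R ⊠ F) (R ⊠ G)
  ⊠-agreeBelow zero    N {R} ord F≈G [] 0<N = *-congˡ (F≈G [] 0<N)
  ⊠-agreeBelow (suc p) N {R} ord F≈G [] _ =
    trans (*-congʳ R[]≈0) (trans (trans (zeroˡ _) (sym (zeroˡ _))) (*-congʳ (sym R[]≈0)))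
    where
    R[]≈0 : R [] ≈ 0#
    R[]≈0 = ord [] (s≤s z≤n)
  ⊠-agreeBelow p N {R} {F} {G} ord F≈G (a ∷ α) lt = ∑-cong (suc a) λ { i (s≤s i≤a) →
    ⊠-agreeBelow (p ∸ i) (N ∸ (a ∸ i)) {slice i R} {slice (a ∸ i) F} {slice (a ∸ i) G}
      (λ β β< → ord (i ∷ β) (m<n∸i⇒i+m<n i p β<))
      (λ β β< → F≈G ((a ∸ i) ∷ β) (m<n∸i⇒i+m<n (a ∸ i) N β<))
      α (split-< (totalDegree α) p N i≤a lt) }

  mvPow-order : ∀ {R} → OrderAtLeast 1 R → ∀ p → OrderAtLeast p (mvPow R p)
  mvPow-order         ord zero    α ()
  mvPow-order {R} ord (suc p) α lt =
    trans (⊠-agreeBelow 1 p ord (mvPow-order ord p) α lt) (proj₂ Mv.zero R α)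

  -- Independence of trailing zeros

  infix 4 _≃_
  _≃_ : Monomial → Monomial → Set
  α ≃ β = ∀ j → exponent α j ≡ exponent β j

  totalDegree-≃ : ∀ α β → α ≃ β → totalDegree α ≡ totalDegree β
  totalDegree-≃ []      []      e = ≡.refl
  totalDegree-≃ []      (b ∷ β) e = ≡.cong₂ ℕ._+_ (e 0) (totalDegree-≃ [] β λ j → e (suc j))
  totalDegree-≃ (a ∷ α) []      e = ≡.cong₂ ℕ._+_ (e 0) (totalDegree-≃ α [] λ j → e (suc j))
  totalDegree-≃ (a ∷ α) (b ∷ β) e = ≡.cong₂ ℕ._+_ (e 0) (totalDegree-≃ α β λ j → e (suc j))

  degreeZero-≃ : ∀ α → totalDegree α ≡ 0 → α ≃ []
  degreeZero-≃ []      e j       = ≡.refl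
  degreeZero-≃ (a ∷ α) e zero    = ℕₚ.m+n≡0⇒m≡0 a e
  degreeZero-≃ (a ∷ α) e (suc j) = degreeZero-≃ α (ℕₚ.m+n≡0⇒n≡0 a e) j

  0∷[]≃[] : (0 ∷ []) ≃ []
  0∷[]≃[] zero    = ≡.refl
  0∷[]≃[] (suc _) = ≡.refl

  exponent-timesVar : ∀ i α j → exponent (timesVar i α) j ≡ exponent (timesVar i []) j ℕ.+ exponent α j
  exponent-timesVar zero    []      zero    = ≡.refl
  exponent-timesVar zero    []      (suc j) = ≡.refl
  exponent-timesVar zero    (a ∷ α) zero    = ≡.refl
  exponent-timesVar zero    (a ∷ α) (suc j) = ≡.refl
  exponent-timesVar (suc i) []      j       = ≡.sym (ℕₚ.+-identityʳ _)
  exponent-timesVar (suc i) (a ∷ α) zero    = ≡.refl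
  exponent-timesVar (suc i) (a ∷ α) (suc j) = exponent-timesVar i α j

  -- The monomial 1 is also written as a list of zeros of any length; only `IsMvSeries` ties the
  -- values there to the one at `[]`.
  constantTerm⇒order : ∀ {F} → IsMvSeries F → F [] ≈ 0# → OrderAtLeast 1 F
  constantTerm⇒order isMv F[]≈0 α (s≤s lt) =
    trans (isMv α [] (degreeZero-≃ α (ℕₚ.n≤0⇒n≡0 lt))) F[]≈0

  slice-isMv : ∀ {F} i → IsMvSeries F → IsMvSeries (slice i F)
  slice-isMv i isMv α β e = isMv (i ∷ α) (i ∷ β) λ { zero → ≡.refl ; (suc j) → e j }

  isMv-[] : ∀ {F} → IsMvSeries F → F (0 ∷ []) ≈ F []
  isMv-[] isMv = isMv (0 ∷ []) [] 0∷[]≃[]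

  mvOne-isMv : IsMvSeries mvOne
  mvOne-isMv []           []           e = refl
  mvOne-isMv []           (zero  ∷ β)  e = mvOne-isMv [] β λ j → e (suc j)
  mvOne-isMv []           (suc _ ∷ β)  e with () ← e 0
  mvOne-isMv (zero  ∷ α)  []           e = mvOne-isMv α [] λ j → e (suc j)
  mvOne-isMv (suc _ ∷ α)  []           e with () ← e 0
  mvOne-isMv (zero  ∷ α)  (zero  ∷ β)  e = mvOne-isMv α β λ j → e (suc j)
  mvOne-isMv (zero  ∷ α)  (suc _ ∷ β)  e with () ← e 0
  mvOne-isMv (suc _ ∷ α)  (zero  ∷ β)  e with () ← e 0
  mvOne-isMv (suc _ ∷ α)  (suc _ ∷ β)  e = refl

  mvVar-[] : ∀ j → mvVar j [] ≈ 0#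
  mvVar-[] zero    = refl
  mvVar-[] (suc j) = refl

  mvVar-isMv : ∀ j → IsMvSeries (mvVar j)
  mvVar-isMv j       []      []      e = refl
  mvVar-isMv zero    []      (b ∷ β) e with ≡.refl ← e 0 = refl
  mvVar-isMv (suc j) []      (b ∷ β) e with ≡.refl ← e 0 =
    trans (sym (mvVar-[] j)) (mvVar-isMv j [] β λ i → e (suc i))
  mvVar-isMv zero    (a ∷ α) []      e with ≡.refl ← e 0 = refl
  mvVar-isMv (suc j) (a ∷ α) []      e with ≡.refl ← e 0 =
    trans (mvVar-isMv j α [] λ i → e (suc i)) (mvVar-[] j)
  mvVar-isMv zero    (zero ∷ α)        (b ∷ β) e with ≡.refl ← e 0 = refl
  mvVar-isMv zero    (suc zero ∷ α)    (b ∷ β) e with ≡.refl ← e 0 = mvOne-isMv α β λ i → e (suc i)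
  mvVar-isMv zero    (suc (suc _) ∷ α) (b ∷ β) e with ≡.refl ← e 0 = refl
  mvVar-isMv (suc j) (zero ∷ α)        (b ∷ β) e with ≡.refl ← e 0 = mvVar-isMv j α β λ i → e (suc i)
  mvVar-isMv (suc j) (suc _ ∷ α)       (b ∷ β) e with ≡.refl ← e 0 = refl

  ⊠-isMv : ∀ {F G} → IsMvSeries F → IsMvSeries G → IsMvSeries (F ⊠ G)
  ⊠-isMv F-isMv G-isMv []      []      e = refl
  ⊠-isMv {F} {G} F-isMv G-isMv []      (b ∷ β) e with ≡.refl ← e 0 = begin
    F [] * G []               ≈⟨ *-cong (isMv-[] F-isMv) (isMv-[] G-isMv) ⟨
    F (0 ∷ []) * G (0 ∷ [])   ≈⟨ ⊠-isMv (slice-isMv 0 F-isMv) (slice-isMv 0 G-isMv) [] β (λ j → e (suc j)) ⟩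
    (slice 0 F ⊠ slice 0 G) β ≈⟨ +-identityʳ _ ⟨
    (F ⊠ G) (0 ∷ β) ∎
  ⊠-isMv {F} {G} F-isMv G-isMv (a ∷ α) []      e with ≡.refl ← e 0 = begin
    (F ⊠ G) (0 ∷ α)           ≈⟨ +-identityʳ _ ⟩
    (slice 0 F ⊠ slice 0 G) α ≈⟨ ⊠-isMv (slice-isMv 0 F-isMv) (slice-isMv 0 G-isMv) α [] (λ j → e (suc j)) ⟩
    F (0 ∷ []) * G (0 ∷ [])   ≈⟨ *-cong (isMv-[] F-isMv) (isMv-[] G-isMv) ⟩
    F [] * G [] ∎
  ⊠-isMv F-isMv G-isMv (a ∷ α) (b ∷ β) e with ≡.refl ← e 0 = ∑-cong′ (suc a) λ i →
    ⊠-isMv (slice-isMv i F-isMv) (slice-isMv (a ∸ i) G-isMv) α β λ j → e (suc j)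

  mvPow-isMv : ∀ {F} → IsMvSeries F → ∀ p → IsMvSeries (mvPow F p)
  mvPow-isMv isMv zero    = mvOne-isMv
  mvPow-isMv isMv (suc p) = ⊠-isMv isMv (mvPow-isMv isMv p)

  ⟦⟧-isMv : ∀ f {F} → IsMvSeries F → IsMvSeries (f ⟦ F ⟧)
  ⟦⟧-isMv f {F} isMv α β e = trans
    (reflexive (≡.cong (λ n → ∑< (suc n) λ p → f p * mvPow F p α) (totalDegree-≃ α β e)))
    (∑-cong′ (suc (totalDegree β)) λ p → *-congˡ {f p} (mvPow-isMv isMv p α β e))

  ∂-isMv : ∀ i {F} → IsMvSeries F → IsMvSeries (∂ i F)
  ∂-isMv i {F} isMv α β e = trans
    (reflexive (≡.cong (λ n → suc n · F (timesVar i α)) (e i)))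
    (·-congʳ (suc (exponent β i)) (isMv (timesVar i α) (timesVar i β) λ j →
      ≡.trans (exponent-timesVar i α j)
        (≡.trans (≡.cong (exponent (timesVar i []) j ℕ.+_) (e j)) (≡.sym (exponent-timesVar i β j)))))

  -- Partial derivatives

  ∂-cong : ∀ j {F G} → F ≋ G → ∂ j F ≋ ∂ j G
  ∂-cong j F≋G α = ·-congʳ (suc (exponent α j)) (F≋G (timesVar j α))

  ∂-⊞ : ∀ j F G → ∂ j (F ⊞ G) ≋ ∂ j F ⊞ ∂ j G
  ∂-⊞ j F G α = ·-distrib-+ _ _ (suc (exponent α j))

  ∂-scale : ∀ j x F → ∂ j (λ α → x * F α) ≋ λ α → x * ∂ j F α
  ∂-scale j x F α = sym (·-comm-* (suc (exponent α j)) x _)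

  ∂-comm : ∀ i j F → ∂ i (∂ j F) ≋ ∂ j (∂ i F)
  ∂-comm zero    zero    F α       = refl
  ∂-comm zero    (suc j) F []      = refl
  ∂-comm zero    (suc j) F (a ∷ α) = ·-swap (suc a) (suc (exponent α j)) _
  ∂-comm (suc i) zero    F []      = refl
  ∂-comm (suc i) zero    F (a ∷ α) = ·-swap (suc (exponent α i)) (suc a) _
  ∂-comm (suc i) (suc j) F []      = ∂-comm i j (slice 0 F) []
  ∂-comm (suc i) (suc j) F (a ∷ α) = ∂-comm i j (slice a F) α

  ∂-mvOne : ∀ j → ∂ j mvOne ≋ mvZero
  ∂-mvOne zero    []          = +-identityˡ 0#
  ∂-mvOne zero    (a ∷ α)     = m·0≈0 (suc a)
  ∂-mvOne (suc j) []          = ∂-mvOne j []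
  ∂-mvOne (suc j) (zero ∷ α)  = ∂-mvOne j α
  ∂-mvOne (suc j) (suc a ∷ α) = m·0≈0 (suc (exponent α j))

  ⊠-·ˡ : ∀ m F G → (λ β → m · F β) ⊠ G ≋ λ β → m · (F ⊠ G) β
  ⊠-·ˡ m F G α = begin
    ((λ β → m · F β) ⊠ G) α       ≈⟨ ⊠-cong {G = G} (λ β → ·-as-* m (F β)) (λ _ → refl) α ⟩
    ((λ β → fromℕ m * F β) ⊠ G) α ≈⟨ ⊠-scaleˡ (fromℕ m) F G α ⟩
    fromℕ m * (F ⊠ G) α           ≈⟨ ·-as-* m _ ⟨
    m · (F ⊠ G) α                 ∎

  ⊠-·ʳ : ∀ m F G → F ⊠ (λ β → m · G β) ≋ λ β → m · (F ⊠ G) β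
  ⊠-·ʳ m F G α = trans (⊠-comm F _ α)
    (trans (⊠-·ˡ m G F α) (·-congʳ m (⊠-comm G F α)))

  -- Write the factor `suc n` as `i + (suc n ∸ i)`. The first weight kills the term with `i = 0`,
  -- the second the last term, and what remains are the two sums of the product rule.
  ∑-leibniz : ∀ n (T : ℕ → ℕ → Carrier) →
    suc n · ∑< (suc (suc n)) (λ i → T i (suc n ∸ i)) ≈
    ∑< (suc n) (λ i → suc i · T (suc i) (n ∸ i)) + ∑< (suc n) (λ i → suc (n ∸ i) · T i (suc (n ∸ i)))
  ∑-leibniz n T = begin
    suc n · ∑< (suc (suc n)) t ≈⟨ ∑-distrib-· (suc (suc n)) (suc n) t ⟩
    ∑< (suc (suc n)) (λ i → suc n · t i) ≈⟨ ∑-cong (suc (suc n)) split ⟩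
    ∑< (suc (suc n)) (λ i → i · t i + (suc n ∸ i) · t i)
      ≈⟨ ∑-distrib-+ (suc (suc n)) (λ i → i · t i) (λ i → (suc n ∸ i) · t i) ⟩
    ∑< (suc (suc n)) (λ i → i · t i) + ∑< (suc (suc n)) (λ i → (suc n ∸ i) · t i)
      ≈⟨ +-cong (+-identityˡ _) (trans (∑-snoc (suc n) (λ i → (suc n ∸ i) · t i))
           (trans (+-congˡ last≈0) (+-identityʳ _))) ⟩
    ∑< (suc n) (λ i → suc i · T (suc i) (n ∸ i)) + ∑< (suc n) (λ i → (suc n ∸ i) · t i)
      ≈⟨ +-congˡ (∑-cong (suc n) λ { i (s≤s i≤n) →
           reflexive (≡.cong (λ m → m · T i m) (ℕₚ.+-∸-assoc 1 i≤n)) }) ⟩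
    ∑< (suc n) (λ i → suc i · T (suc i) (n ∸ i)) + ∑< (suc n) (λ i → suc (n ∸ i) · T i (suc (n ∸ i))) ∎
    where
    t : ℕ → Carrier
    t i = T i (suc n ∸ i)

    split : ∀ i → i < suc (suc n) → suc n · t i ≈ i · t i + (suc n ∸ i) · t i
    split i (s≤s i≤) = trans (reflexive (≡.cong (_· t i) (≡.sym (ℕₚ.m+[n∸m]≡n i≤))))
      (·-homo-+ (t i) i (suc n ∸ i))

    last≈0 : (suc n ∸ suc n) · t (suc n) ≈ 0#
    last≈0 = reflexive (≡.cong (_· t (suc n)) (ℕₚ.n∸n≡0 n))

  -- `timesVar` can lengthen a list, so at `[]` the left side involves values at `0 ∷ []` and the
  -- right side values at `[]`; the hypotheses on `F` and `G` identify them.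
  ∂-⊠ : ∀ j {F G} → IsMvSeries F → IsMvSeries G → ∂ j (F ⊠ G) ≋ ∂ j F ⊠ G ⊞ F ⊠ ∂ j G
  ∂-⊠ zero    {F} {G} F-isMv G-isMv [] = begin
    1 · (F (0 ∷ []) * G (1 ∷ []) + (F (1 ∷ []) * G (0 ∷ []) + 0#))
      ≈⟨ ·-congʳ 1 (+-cong (*-congʳ (isMv-[] F-isMv)) (+-congʳ (*-congˡ (isMv-[] G-isMv)))) ⟩
    1 · (F [] * G (1 ∷ []) + (F (1 ∷ []) * G [] + 0#))
      ≈⟨ Solver.solve 4 (λ a b c d → (a :* b :+ (c :* d :+ con 0)) :+ con 0 :=
           (c :+ con 0) :* d :+ a :* (b :+ con 0)) refl (F []) (G (1 ∷ [])) (F (1 ∷ [])) (G []) ⟩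
    (1 · F (1 ∷ [])) * G [] + F [] * (1 · G (1 ∷ [])) ∎
    where open Solver using (_:+_; _:*_; _:=_; con)
  ∂-⊠ zero    {F} {G} F-isMv G-isMv (a ∷ α) = begin
    suc a · ∑< (suc (suc a)) (λ i → T i (suc a ∸ i)) ≈⟨ ∑-leibniz a T ⟩
    ∑< (suc a) (λ i → suc i · T (suc i) (a ∸ i)) + ∑< (suc a) (λ i → suc (a ∸ i) · T i (suc (a ∸ i)))
      ≈⟨ +-cong (∑-cong′ (suc a) λ i → ⊠-·ˡ (suc i) (slice (suc i) F) (slice (a ∸ i) G) α)
                (∑-cong′ (suc a) λ i → ⊠-·ʳ (suc (a ∸ i)) (slice i F) (slice (suc (a ∸ i)) G) α) ⟨
    (∂ 0 F ⊠ G ⊞ F ⊠ ∂ 0 G) (a ∷ α) ∎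
    where
    T : ℕ → ℕ → Carrier
    T i j = (slice i F ⊠ slice j G) α
  ∂-⊠ (suc j) {F} {G} F-isMv G-isMv [] = begin
    ∂ (suc j) (F ⊠ G) []
      ≈⟨ ·-congʳ 1 (+-identityʳ _) ⟩
    ∂ j (slice 0 F ⊠ slice 0 G) []
      ≈⟨ ∂-⊠ j (slice-isMv 0 F-isMv) (slice-isMv 0 G-isMv) [] ⟩
    ∂ j (slice 0 F) [] * G (0 ∷ []) + F (0 ∷ []) * ∂ j (slice 0 G) []
      ≈⟨ +-cong (*-congˡ (isMv-[] G-isMv)) (*-congʳ (isMv-[] F-isMv)) ⟩
    (∂ (suc j) F ⊠ G ⊞ F ⊠ ∂ (suc j) G) [] ∎
  ∂-⊠ (suc j) {F} {G} F-isMv G-isMv (a ∷ α) = begin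
    ∂ (suc j) (F ⊠ G) (a ∷ α)
      ≈⟨ ∑-distrib-· (suc a) (suc (exponent α j)) (λ i → (slice i F ⊠ slice (a ∸ i) G) (timesVar j α)) ⟩
    ∑< (suc a) (λ i → ∂ j (slice i F ⊠ slice (a ∸ i) G) α)
      ≈⟨ ∑-cong′ (suc a) (λ i → ∂-⊠ j (slice-isMv i F-isMv) (slice-isMv (a ∸ i) G-isMv) α) ⟩
    ∑< (suc a) (λ i → (∂ j (slice i F) ⊠ slice (a ∸ i) G) α + (slice i F ⊠ ∂ j (slice (a ∸ i) G)) α)
      ≈⟨ ∑-distrib-+ (suc a) (λ i → (∂ j (slice i F) ⊠ slice (a ∸ i) G) α)
           (λ i → (slice i F ⊠ ∂ j (slice (a ∸ i) G)) α) ⟩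
    (∂ (suc j) F ⊠ G ⊞ F ⊠ ∂ (suc j) G) (a ∷ α) ∎

  -- Univariate series

  infix 4 _≗_
  _≗_ : PowerSeries → PowerSeries → Set ℓ₁
  f ≗ g = ∀ n → f n ≈ g n

  infixl 6 _⊕_
  _⊕_ : PowerSeries → PowerSeries → PowerSeries
  (f ⊕ g) n = f n + g n

  tail shift : PowerSeries → PowerSeries
  tail f n = f (suc n)
  shift f zero    = 0#
  shift f (suc n) = f n

  -- The univariate product is the multivariate one on monomials n ∷ [].
  inX₀ : PowerSeries → MvSeries
  inX₀ f []      = 0#
  inX₀ f (n ∷ _) = f n

  ⊛-cong : ∀ {f f′ g g′} → f ≗ f′ → g ≗ g′ → f ⊛ g ≗ f′ ⊛ g′
  ⊛-cong f≗ g≗ n = ∑-cong′ (suc n) λ i → *-cong (f≗ i) (g≗ (n ∸ i))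

  ⊛-comm : ∀ f g → f ⊛ g ≗ g ⊛ f
  ⊛-comm f g n = ⊠-comm (inX₀ f) (inX₀ g) (n ∷ [])

  ⊛-assoc : ∀ f g h → (f ⊛ g) ⊛ h ≗ f ⊛ (g ⊛ h)
  ⊛-assoc f g h n = ⊠-assoc (inX₀ f) (inX₀ g) (inX₀ h) (n ∷ [])

  ⊛-identityˡ : ∀ f → one ⊛ f ≗ f
  ⊛-identityˡ f n = trans (+-cong (*-identityˡ (f n)) (∑-zero n λ i _ → zeroˡ (f (n ∸ suc i))))
    (+-identityʳ (f n))

  ⊛-identityʳ : ∀ f → f ⊛ one ≗ f
  ⊛-identityʳ f n = trans (⊛-comm f one n) (⊛-identityˡ f n)

  -- Multiply out f = f(0) + r · `tail f`. Peeling off one power of r in this way drives the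
  -- recursions used for substitution.
  ⊛-unfold : ∀ f g n → (f ⊛ g) n ≈ f 0 * g n + shift (tail f ⊛ g) n
  ⊛-unfold f g zero    = refl
  ⊛-unfold f g (suc n) = refl

  deriv-unfold : ∀ f n → deriv f n ≈ tail f n + shift (deriv (tail f)) n
  deriv-unfold f zero    = refl
  deriv-unfold f (suc n) = refl

  deriv-integral : ∀ f → deriv (integral f) ≗ f
  deriv-integral f n = begin
    suc n · (recip (suc n) * f n)          ≈⟨ ·-as-* (suc n) (recip (suc n) * f n) ⟩
    fromℕ (suc n) * (recip (suc n) * f n)  ≈⟨ *-assoc _ _ _ ⟨
    fromℕ (suc n) * recip (suc n) * f n    ≈⟨ *-congʳ (trans (*-comm _ _) (recip-inverseˡ (suc n))) ⟩
    1# * f n                               ≈⟨ *-identityˡ _ ⟩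
    f n                                    ∎

  -- Substitution

  ⟦⟧-cong : ∀ {f g} R → f ≗ g → f ⟦ R ⟧ ≋ g ⟦ R ⟧
  ⟦⟧-cong R f≗g α = ∑-cong′ (suc (totalDegree α)) λ p → *-congʳ {mvPow R p α} (f≗g p)

  ⟦⟧-⊕ : ∀ f g R → (f ⊕ g) ⟦ R ⟧ ≋ f ⟦ R ⟧ ⊞ g ⟦ R ⟧
  ⟦⟧-⊕ f g R α = trans (∑-cong′ (suc (totalDegree α)) λ p → distribʳ (mvPow R p α) (f p) (g p))
    (∑-distrib-+ (suc (totalDegree α)) (λ p → f p * mvPow R p α) (λ p → g p * mvPow R p α))

  ⟦⟧-scale : ∀ x f R → (λ n → x * f n) ⟦ R ⟧ ≋ λ α → x * (f ⟦ R ⟧) α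
  ⟦⟧-scale x f R α = trans (∑-cong′ (suc (totalDegree α)) λ p → *-assoc x (f p) (mvPow R p α))
    (sym (∑-distribˡ-* (suc (totalDegree α)) x (λ p → f p * mvPow R p α)))

  one⟦⟧ : ∀ R → one ⟦ R ⟧ ≋ mvOne
  one⟦⟧ R α = trans (+-cong (*-identityˡ _) (∑-zero (totalDegree α) λ p _ → zeroˡ (mvPow R (suc p) α)))
    (+-identityʳ _)

  module Substitution {R : MvSeries} (R-isMv : IsMvSeries R) (R-order : OrderAtLeast 1 R) where

    ⟦⟧-unfold : ∀ f → f ⟦ R ⟧ ≋ (λ α → f 0 * mvOne α) ⊞ R ⊠ tail f ⟦ R ⟧
    ⟦⟧-unfold f α = +-congˡ (sym (begin
      (R ⊠ tail f ⟦ R ⟧) α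
        -- The sum in `tail f ⟦ R ⟧` stops at the degree of its argument. Since `R` has order 1,
        -- only arguments of degree below `N` matter, and there a common stop at `N` adds vanishing
        -- terms only.
        ≈⟨ ⊠-agreeBelow 1 N R-order (λ β β<N → sym (∑-extend (term β) β<N (vanish β))) α (s≤s ℕₚ.≤-refl) ⟩
      (R ⊠ ∑ₘ N (λ p β → term β p)) α
        ≈⟨ ⊠-∑ˡ N R (λ p β → term β p) α ⟩
      ∑< N (λ p → (R ⊠ (λ β → f (suc p) * mvPow R p β)) α)
        ≈⟨ ∑-cong′ N (λ p → ⊠-scaleʳ (f (suc p)) R (mvPow R p) α) ⟩
      ∑< N (λ p → f (suc p) * mvPow R (suc p) α) ∎))
      where
      N : ℕ
      N = totalDegree α

      term : Monomial → ℕ → Carrier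
      term β p = f (suc p) * mvPow R p β

      vanish : ∀ β p → suc (totalDegree β) ≤ p → term β p ≈ 0#
      vanish β p β<p = trans (*-congˡ (mvPow-order R-order p β β<p)) (zeroʳ _)

    -- The recursion f ↦ tail f raises the order by one at each step, so it
    -- determines its solution.
    recursion-unique : (Φ Ψ C : PowerSeries → MvSeries) →
      (∀ f → Φ f ≋ C f ⊞ R ⊠ Φ (tail f)) → (∀ f → Ψ f ≋ C f ⊞ R ⊠ Ψ (tail f)) →
      ∀ f → Φ f ≋ Ψ f
    recursion-unique Φ Ψ C Φ-rec Ψ-rec f α = below (suc (totalDegree α)) f α ℕₚ.≤-refl
      where
      below : ∀ N f → AgreeBelow N (Φ f) (Ψ f)
      below zero    f β ()
      below (suc N) f β β< = begin
        Φ f β                       ≈⟨ Φ-rec f β ⟩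
        C f β + (R ⊠ Φ (tail f)) β  ≈⟨ +-congˡ (⊠-agreeBelow 1 N R-order (below N (tail f)) β β<) ⟩
        C f β + (R ⊠ Ψ (tail f)) β  ≈⟨ Ψ-rec f β ⟨
        Ψ f β                       ∎

    shift⟦⟧ : ∀ f → shift f ⟦ R ⟧ ≋ R ⊠ f ⟦ R ⟧
    shift⟦⟧ f α = trans (⟦⟧-unfold (shift f) α) (trans (+-congʳ (zeroˡ _)) (+-identityˡ _))

    -- As functions of `f`, both sides solve the recursion whose inhomogeneous term is f(0) · g(R).
    ⟦⟧-⊛ : ∀ f g → (f ⊛ g) ⟦ R ⟧ ≋ f ⟦ R ⟧ ⊠ g ⟦ R ⟧
    ⟦⟧-⊛ f g = recursion-unique (λ f → (f ⊛ g) ⟦ R ⟧) (λ f → f ⟦ R ⟧ ⊠ g ⟦ R ⟧)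
      (λ f α → f 0 * (g ⟦ R ⟧) α)
      (λ f α → begin
        ((f ⊛ g) ⟦ R ⟧) α
          ≈⟨ ⟦⟧-cong R (⊛-unfold f g) α ⟩
        (((λ n → f 0 * g n) ⊕ shift (tail f ⊛ g)) ⟦ R ⟧) α
          ≈⟨ ⟦⟧-⊕ (λ n → f 0 * g n) (shift (tail f ⊛ g)) R α ⟩
        ((λ n → f 0 * g n) ⟦ R ⟧) α + (shift (tail f ⊛ g) ⟦ R ⟧) α
          ≈⟨ +-cong (⟦⟧-scale (f 0) g R α) (shift⟦⟧ (tail f ⊛ g) α) ⟩
        f 0 * (g ⟦ R ⟧) α + (R ⊠ (tail f ⊛ g) ⟦ R ⟧) α ∎)
      (λ f α → begin
        (f ⟦ R ⟧ ⊠ g ⟦ R ⟧) α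
          ≈⟨ ⊠-cong {G = g ⟦ R ⟧} (⟦⟧-unfold f) (λ _ → refl) α ⟩
        (((λ α → f 0 * mvOne α) ⊞ R ⊠ tail f ⟦ R ⟧) ⊠ g ⟦ R ⟧) α
          ≈⟨ ⊠-distribʳ (g ⟦ R ⟧) (λ α → f 0 * mvOne α) (R ⊠ tail f ⟦ R ⟧) α ⟩
        ((λ α → f 0 * mvOne α) ⊠ g ⟦ R ⟧) α + ((R ⊠ tail f ⟦ R ⟧) ⊠ g ⟦ R ⟧) α
          ≈⟨ +-cong (trans (⊠-scaleˡ (f 0) mvOne (g ⟦ R ⟧) α) (*-congˡ (⊠-identityˡ (g ⟦ R ⟧) α)))
                    (⊠-assoc R (tail f ⟦ R ⟧) (g ⟦ R ⟧) α) ⟩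
        f 0 * (g ⟦ R ⟧) α + (R ⊠ (tail f ⟦ R ⟧ ⊠ g ⟦ R ⟧)) α ∎)
      f

    -- Both sides solve the recursion with inhomogeneous term ∂ⱼR · (`tail f`)(R): on the left by
    -- the product rule, on the right by f′ = `tail f` + r (`tail f`)′.
    ∂-⟦⟧ : ∀ j f → ∂ j (f ⟦ R ⟧) ≋ deriv f ⟦ R ⟧ ⊠ ∂ j R
    ∂-⟦⟧ j = recursion-unique (λ f → ∂ j (f ⟦ R ⟧)) (λ f → deriv f ⟦ R ⟧ ⊠ ∂ j R)
      (λ f → ∂ j R ⊠ tail f ⟦ R ⟧)
      (λ f α → begin
        ∂ j (f ⟦ R ⟧) α
          ≈⟨ ∂-cong j (⟦⟧-unfold f) α ⟩
        ∂ j ((λ α → f 0 * mvOne α) ⊞ R ⊠ tail f ⟦ R ⟧) α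
          ≈⟨ ∂-⊞ j (λ α → f 0 * mvOne α) (R ⊠ tail f ⟦ R ⟧) α ⟩
        ∂ j (λ α → f 0 * mvOne α) α + ∂ j (R ⊠ tail f ⟦ R ⟧) α
          ≈⟨ +-cong (trans (∂-scale j (f 0) mvOne α) (trans (*-congˡ (∂-mvOne j α)) (zeroʳ _)))
                    (∂-⊠ j R-isMv (⟦⟧-isMv (tail f) R-isMv) α) ⟩
        0# + (∂ j R ⊠ tail f ⟦ R ⟧ ⊞ R ⊠ ∂ j (tail f ⟦ R ⟧)) α
          ≈⟨ +-identityˡ _ ⟩
        (∂ j R ⊠ tail f ⟦ R ⟧ ⊞ R ⊠ ∂ j (tail f ⟦ R ⟧)) α ∎)
      (λ f α → begin
        (deriv f ⟦ R ⟧ ⊠ ∂ j R) α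
          ≈⟨ ⊠-cong {G = ∂ j R} (λ β → trans (⟦⟧-cong R (deriv-unfold f) β)
               (trans (⟦⟧-⊕ (tail f) (shift (deriv (tail f))) R β) (+-congˡ (shift⟦⟧ (deriv (tail f)) β))))
               (λ _ → refl) α ⟩
        ((tail f ⟦ R ⟧ ⊞ R ⊠ deriv (tail f) ⟦ R ⟧) ⊠ ∂ j R) α
          ≈⟨ MvSolver.solve 4 (λ t r d x → (t :+ r :* d) :* x := x :* t :+ r :* (d :* x)) (λ _ → refl)
               (tail f ⟦ R ⟧) R (deriv (tail f) ⟦ R ⟧) (∂ j R) α ⟩
        (∂ j R ⊠ tail f ⟦ R ⟧ ⊞ R ⊠ (deriv (tail f) ⟦ R ⟧ ⊠ ∂ j R)) α ∎)
      where open MvSolver using (_:+_; _:*_; _:=_)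

  -- Series ∑ Gⱼ xⱼ

  ∑-single : ∀ {n i} (t : ℕ → Carrier) → i < n → (∀ j → i ≢ j → t j ≈ 0#) → ∑< n t ≈ t i
  ∑-single {suc n} {zero}  t (s≤s i<n) t≈0 =
    trans (+-congˡ (∑-zero n λ j _ → t≈0 (suc j) λ ())) (+-identityʳ _)
  ∑-single {suc n} {suc i} t (s≤s i<n) t≈0 = trans
    (+-cong (t≈0 0 λ ()) (∑-single (λ j → t (suc j)) i<n λ j i≢j → t≈0 (suc j) λ { ≡.refl → i≢j ≡.refl }))
    (+-identityˡ _)

  ∂-mvVar-same : ∀ j → ∂ j (mvVar j) ≋ mvOne
  ∂-mvVar-same zero    []          = +-identityʳ _
  ∂-mvVar-same zero    (zero ∷ α)  = +-identityʳ _
  ∂-mvVar-same zero    (suc a ∷ α) = m·0≈0 (suc (suc a))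
  ∂-mvVar-same (suc j) []          = ∂-mvVar-same j []
  ∂-mvVar-same (suc j) (zero ∷ α)  = ∂-mvVar-same j α
  ∂-mvVar-same (suc j) (suc a ∷ α) = m·0≈0 (suc (exponent α j))

  ∂-mvVar-diff : ∀ i j → i ≢ j → ∂ i (mvVar j) ≋ mvZero
  ∂-mvVar-diff zero    zero    i≢j _       = ⊥-elim (i≢j ≡.refl)
  ∂-mvVar-diff zero    (suc j) i≢j []      = m·0≈0 1
  ∂-mvVar-diff zero    (suc j) i≢j (a ∷ α) = m·0≈0 (suc a)
  ∂-mvVar-diff (suc i) zero    i≢j []      = m·0≈0 1
  ∂-mvVar-diff (suc i) zero    i≢j (zero ∷ α)        = m·0≈0 (suc (exponent α i))
  ∂-mvVar-diff (suc i) zero    i≢j (suc zero ∷ α)    = ∂-mvOne i α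
  ∂-mvVar-diff (suc i) zero    i≢j (suc (suc _) ∷ α) = m·0≈0 (suc (exponent α i))
  ∂-mvVar-diff (suc i) (suc j) i≢j []          = ∂-mvVar-diff i j (λ { ≡.refl → i≢j ≡.refl }) []
  ∂-mvVar-diff (suc i) (suc j) i≢j (zero ∷ α)  = ∂-mvVar-diff i j (λ { ≡.refl → i≢j ≡.refl }) α
  ∂-mvVar-diff (suc i) (suc j) i≢j (suc _ ∷ α) = m·0≈0 (suc (exponent α i))

  mvVar-absent : ∀ j α → length α ≤ j → mvVar j α ≈ 0#
  mvVar-absent j       []          _        = mvVar-[] j
  mvVar-absent (suc j) (zero ∷ α)  (s≤s le) = mvVar-absent j α le
  mvVar-absent (suc j) (suc _ ∷ α) _        = refl

  ⊠-mvVar-absent : ∀ F j α → length α ≤ j → (F ⊠ mvVar j) α ≈ 0#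
  ⊠-mvVar-absent F j α le = trans
    (⊠-cong-length α (λ _ _ → refl) λ β eq → mvVar-absent j β (≡.subst (_≤ j) (≡.sym eq) le))
    (proj₂ Mv.zero F α)

  length-timesVar : ∀ i α → length α ≤ length (timesVar i α)
  length-timesVar i       []      = z≤n
  length-timesVar zero    (a ∷ α) = ℕₚ.≤-refl
  length-timesVar (suc i) (a ∷ α) = s≤s (length-timesVar i α)

  index<length-timesVar : ∀ i α → i < length (timesVar i α)
  index<length-timesVar zero    []      = s≤s z≤n
  index<length-timesVar zero    (a ∷ α) = s≤s z≤n
  index<length-timesVar (suc i) []      = s≤s (index<length-timesVar i [])
  index<length-timesVar (suc i) (a ∷ α) = s≤s (index<length-timesVar i α)

  -- At `timesVar i α` the sum can have more terms than at `α`. In the part where `G j` is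
  -- differentiated, the extra terms vanish because `α` does not involve their variables. In the
  -- other part only `j = i` survives, and the longer list is sure to include it.
  ∂-∑x : ∀ i (G : ℕ → MvSeries) → (∀ j → IsMvSeries (G j)) →
         ∂ i (∑x G) ≋ ∑x (λ j → ∂ i (G j)) ⊞ G i
  ∂-∑x i G G-isMv α = begin
    ∂ i (∑x G) α
      ≈⟨ ∑-distrib-· N (suc (exponent α i)) (λ j → (G j ⊠ mvVar j) (timesVar i α)) ⟩
    ∑< N (λ j → ∂ i (G j ⊠ mvVar j) α)
      ≈⟨ ∑-cong′ N (λ j → ∂-⊠ i (G-isMv j) (mvVar-isMv j) α) ⟩
    ∑< N (λ j → (∂ i (G j) ⊠ mvVar j) α + (G j ⊠ ∂ i (mvVar j)) α)
      ≈⟨ ∑-distrib-+ N (λ j → (∂ i (G j) ⊠ mvVar j) α) (λ j → (G j ⊠ ∂ i (mvVar j)) α) ⟩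
    ∑< N (λ j → (∂ i (G j) ⊠ mvVar j) α) + ∑< N (λ j → (G j ⊠ ∂ i (mvVar j)) α)
      ≈⟨ +-cong
           (∑-extend (λ j → (∂ i (G j) ⊠ mvVar j) α) (length-timesVar i α) λ j → ⊠-mvVar-absent (∂ i (G j)) j α)
           (∑-single (λ j → (G j ⊠ ∂ i (mvVar j)) α) (index<length-timesVar i α) λ j i≢j →
             trans (⊠-cong {F = G j} (λ _ → refl) (∂-mvVar-diff i j i≢j) α) (proj₂ Mv.zero (G j) α)) ⟩
    ∑x (λ j → ∂ i (G j)) α + (G i ⊠ ∂ i (mvVar i)) α
      ≈⟨ +-congˡ (trans (⊠-cong {F = G i} (λ _ → refl) (∂-mvVar-same i) α) (proj₂ Mv.*-identity (G i) α)) ⟩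
    ∑x (λ j → ∂ i (G j)) α + G i α ∎
    where
    N : ℕ
    N = length (timesVar i α)

  ∑x-cong : ∀ {G H : ℕ → MvSeries} → (∀ j → G j ≋ H j) → ∑x G ≋ ∑x H
  ∑x-cong G≋H α = ∑-cong′ (length α) λ j → ⊠-cong {G = mvVar j} (G≋H j) (λ _ → refl) α

  ∑x-⊠ : ∀ (G : ℕ → MvSeries) F → ∑x (λ j → G j ⊠ F) ≋ ∑x G ⊠ F
  ∑x-⊠ G F α = begin
    ∑< N (λ j → (G j ⊠ F ⊠ mvVar j) α)
      ≈⟨ ∑-cong′ N (λ j → MvSolver.solve 3 (λ g f x → (g :* f) :* x := (g :* x) :* f) (λ _ → refl)
           (G j) F (mvVar j) α) ⟩
    ∑< N (λ j → (G j ⊠ mvVar j ⊠ F) α)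
      ≈⟨ ⊠-∑ʳ N F (λ j → G j ⊠ mvVar j) α ⟨
    (∑ₘ N (λ j → G j ⊠ mvVar j) ⊠ F) α
      -- The left factor is evaluated only at lists of the length of `α`, where `∑x G` has exactly
      -- `N` summands.
      ≈⟨ ⊠-cong-length α (λ β eq → reflexive (≡.cong (λ n → ∑< n λ j → (G j ⊠ mvVar j) β) (≡.sym eq)))
           (λ _ _ → refl) ⟩
    (∑x G ⊠ F) α ∎
    where
    open MvSolver using (_:*_; _:=_)
    N : ℕ
    N = length α

  -- For p ≥ 1 the factor with m = 0 is b² - b².
  I-diagonal : ∀ b → I b (b ℕ.+ 0) ≗ one
  I-diagonal b zero    = trans (*-identityʳ _) (trans (*-cong recip-1 recip-1) (*-identityˡ 1#))
  I-diagonal b (suc p) = trans (*-congˡ (trans (*-congʳ factor) (zeroˡ _))) (zeroʳ _)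
    where
    factor : fromℕ (b ℕ.+ 0) ^ 2 - (fromℕ b - fromℕ 0) ^ 2 ≈ 0#
    factor = begin
      fromℕ (b ℕ.+ 0) ^ 2 - (fromℕ b - 0#) ^ 2
        ≈⟨ +-cong (reflexive (≡.cong (λ n → fromℕ n ^ 2) (ℕₚ.+-identityʳ b)))
                  (-‿cong (*-cong (x-0≈x _) (*-congʳ (x-0≈x _)))) ⟩
      fromℕ b ^ 2 - fromℕ b ^ 2 ≈⟨ -‿inverseʳ _ ⟩
      0# ∎

  -- Iterated derivatives in x₀ and restriction to the x₀ axis

  ∂₀^ : ℕ → MvSeries → MvSeries
  ∂₀^ zero    F = F
  ∂₀^ (suc k) F = ∂ 0 (∂₀^ k F)

  ∂₀^-cong : ∀ k {F G} → F ≋ G → ∂₀^ k F ≋ ∂₀^ k G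
  ∂₀^-cong zero    F≋G = F≋G
  ∂₀^-cong (suc k) F≋G = ∂-cong 0 (∂₀^-cong k F≋G)

  ∂₀^-∂ : ∀ k j F → ∂ j (∂₀^ k F) ≋ ∂₀^ k (∂ j F)
  ∂₀^-∂ zero    j F α = refl
  ∂₀^-∂ (suc k) j F α = trans (∂-comm j 0 (∂₀^ k F) α) (∂-cong 0 (∂₀^-∂ k j F) α)

  ∂₀^-suc : ∀ k F → ∂₀^ k (∂ 0 F) ≋ ∂₀^ (suc k) F
  ∂₀^-suc k F α = sym (∂₀^-∂ k 0 F α)

  ∂₀^-isMv : ∀ k {F} → IsMvSeries F → IsMvSeries (∂₀^ k F)
  ∂₀^-isMv zero    isMv = isMv
  ∂₀^-isMv (suc k) isMv = ∂-isMv 0 (∂₀^-isMv k isMv)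

  -- The true factor is (k + n)!/n!; clearing `n !` avoids the quotient and suits the induction, in
  -- which `n` grows as `k` shrinks.
  ∂₀^-at : ∀ k n F → (n !) · ∂₀^ k F (n ∷ []) ≈ ((k ℕ.+ n) !) · F (k ℕ.+ n ∷ [])
  ∂₀^-at zero    n F = refl
  ∂₀^-at (suc k) n F = begin
    (n !) · (suc n · ∂₀^ k F (suc n ∷ []))      ≈⟨ ·-swap (n !) (suc n) _ ⟩
    suc n · ((n !) · ∂₀^ k F (suc n ∷ []))      ≈⟨ ·-assocˡ _ (suc n) (n !) ⟩
    (suc n !) · ∂₀^ k F (suc n ∷ [])            ≈⟨ ∂₀^-at k (suc n) F ⟩
    ((k ℕ.+ suc n) !) · F (k ℕ.+ suc n ∷ [])
      ≈⟨ reflexive (≡.cong (λ m → (m !) · F (m ∷ [])) (ℕₚ.+-suc k n)) ⟩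
    ((suc k ℕ.+ n) !) · F (suc k ℕ.+ n ∷ [])    ∎

  ∂₀^-atOrigin : ∀ k {F} → IsMvSeries F → ∂₀^ k F [] ≈ (k !) · F (k ∷ [])
  ∂₀^-atOrigin k {F} isMv = begin
    ∂₀^ k F []                         ≈⟨ isMv-[] (∂₀^-isMv k isMv) ⟨
    ∂₀^ k F (0 ∷ [])                   ≈⟨ ·-homo-1 _ ⟨
    (0 !) · ∂₀^ k F (0 ∷ [])           ≈⟨ ∂₀^-at k 0 F ⟩
    ((k ℕ.+ 0) !) · F (k ℕ.+ 0 ∷ [])   ≈⟨ reflexive (≡.cong (λ m → (m !) · F (m ∷ [])) (ℕₚ.+-identityʳ k)) ⟩
    (k !) · F (k ∷ [])                 ∎

  pow-restrict : ∀ (R : MvSeries) p n → mvPow R p (n ∷ []) ≈ pow (λ m → R (m ∷ [])) p n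
  pow-restrict R zero    zero    = refl
  pow-restrict R zero    (suc n) = refl
  pow-restrict R (suc p) n       = ∑-cong′ (suc n) λ i → *-congˡ {R (i ∷ [])} (pow-restrict R p (n ∸ i))

  ⟦⟧-restrict : ∀ f (R : MvSeries) n → (f ⟦ R ⟧) (n ∷ []) ≈ (f ⊚ (λ m → R (m ∷ []))) n
  ⟦⟧-restrict f R n = trans
    (reflexive (≡.cong (λ m → ∑< (suc m) λ p → f p * mvPow R p (n ∷ [])) (ℕₚ.+-identityʳ n)))
    (∑-cong′ (suc n) λ p → *-congˡ {f p} (pow-restrict R p n))

  -- Derivatives of f(R̂) reduced to derivatives in x̂_b

  module _ {b : ℕ} {R : MvSeries} (isR̂ : IsR̂ b R) where

    open IsR̂ isR̂
    open Substitution isMvSeries (constantTerm⇒order isMvSeries zeroConstantTerm)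

    equation′ : J b ⟦ R ⟧ ≋ ∑x (λ j → I b (b ℕ.+ j) ⟦ R ⟧)
    equation′ α = x-y≈0⇒x≈y _ _ (equation α)

    I₀⟦R⟧ : I b (b ℕ.+ 0) ⟦ R ⟧ ≋ mvOne
    I₀⟦R⟧ α = trans (⟦⟧-cong R (I-diagonal b) α) (one⟦⟧ R α)

    -- Rearranged, this reads (D - W) ∂ᵢR = I(b, b + i; R) with D - W independent of `i`. For
    -- `i = 0` the right side is 1, so ∂₀R is the inverse of D - W; no series has to be inverted by
    -- hand.
    ∂-equation : ∀ i → deriv (J b) ⟦ R ⟧ ⊠ ∂ i R ≋
      ∑x (λ j → deriv (I b (b ℕ.+ j)) ⟦ R ⟧) ⊠ ∂ i R ⊞ I b (b ℕ.+ i) ⟦ R ⟧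
    ∂-equation i α = begin
      (deriv (J b) ⟦ R ⟧ ⊠ ∂ i R) α ≈⟨ ∂-⟦⟧ i (J b) α ⟨
      ∂ i (J b ⟦ R ⟧) α             ≈⟨ ∂-cong i equation′ α ⟩
      ∂ i (∑x (λ j → Iⱼ j ⟦ R ⟧)) α  ≈⟨ ∂-∑x i (λ j → Iⱼ j ⟦ R ⟧) (λ j → ⟦⟧-isMv (Iⱼ j) isMvSeries) α ⟩
      ∑x (λ j → ∂ i (Iⱼ j ⟦ R ⟧)) α + (Iⱼ i ⟦ R ⟧) α
        ≈⟨ +-congʳ (∑x-cong (λ j → ∂-⟦⟧ i (Iⱼ j)) α) ⟩
      ∑x (λ j → deriv (Iⱼ j) ⟦ R ⟧ ⊠ ∂ i R) α + (Iⱼ i ⟦ R ⟧) α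
        ≈⟨ +-congʳ (∑x-⊠ (λ j → deriv (Iⱼ j) ⟦ R ⟧) (∂ i R) α) ⟩
      (∑x (λ j → deriv (Iⱼ j) ⟦ R ⟧) ⊠ ∂ i R) α + (Iⱼ i ⟦ R ⟧) α ∎
      where
      Iⱼ : ℕ → PowerSeries
      Iⱼ j = I b (b ℕ.+ j)

    -- With D = J′(R) and W = ∑ Iⱼ′(R) xⱼ, expand D ∂ⱼR ∂₀R in two ways.
    ∂R : ∀ j → ∂ j R ≋ I b (b ℕ.+ j) ⟦ R ⟧ ⊠ ∂ 0 R
    ∂R j α = +-cancelʳ ((W ⊠ X ⊠ Y) α) _ _ (begin
      X α + (W ⊠ X ⊠ Y) α
        ≈⟨ MvSolver.solve 3 (λ w x y → x :+ w :* x :* y := (w :* y :+ con 1) :* x) (λ _ → refl) W X Y α ⟩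
      ((W ⊠ Y ⊞ mvOne) ⊠ X) α
        ≈⟨ ⊠-cong {G = X} (λ β → trans (+-congˡ (sym (I₀⟦R⟧ β))) (sym (∂-equation 0 β)))
             (λ _ → refl) α ⟩
      (D ⊠ Y ⊠ X) α
        ≈⟨ MvSolver.solve 3 (λ d x y → d :* y :* x := d :* x :* y) (λ _ → refl) D X Y α ⟩
      (D ⊠ X ⊠ Y) α
        ≈⟨ ⊠-cong {G = Y} (∂-equation j) (λ _ → refl) α ⟩
      ((W ⊠ X ⊞ A) ⊠ Y) α
        ≈⟨ MvSolver.solve 4 (λ w x y a → (w :* x :+ a) :* y := a :* y :+ w :* x :* y) (λ _ → refl) W X Y A α ⟩
      (A ⊠ Y) α + (W ⊠ X ⊠ Y) α ∎)
      where
      open MvSolver using (_:+_; _:*_; _:=_; con)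
      A D W X Y : MvSeries
      A = I b (b ℕ.+ j) ⟦ R ⟧
      D = deriv (J b) ⟦ R ⟧
      W = ∑x (λ j → deriv (I b (b ℕ.+ j)) ⟦ R ⟧)
      X = ∂ j R
      Y = ∂ 0 R

    -- By the chain rule `g` counts only through its derivative, so any antiderivative of h′ I will
    -- do. The factor I(R) in ∂ⱼR is absorbed into g′, which trades `∂ j` for `∂ 0`.
    ∂-reduce : ∀ j h g → deriv g ≗ deriv h ⊛ I b (b ℕ.+ j) → ∂ j (h ⟦ R ⟧) ≋ ∂ 0 (g ⟦ R ⟧)
    ∂-reduce j h g g′≗ α = begin
      ∂ j (h ⟦ R ⟧) α                                   ≈⟨ ∂-⟦⟧ j h α ⟩
      (deriv h ⟦ R ⟧ ⊠ ∂ j R) α                         ≈⟨ ⊠-cong {F = deriv h ⟦ R ⟧} (λ _ → refl) (∂R j) α ⟩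
      (deriv h ⟦ R ⟧ ⊠ (I b (b ℕ.+ j) ⟦ R ⟧ ⊠ ∂ 0 R)) α ≈⟨ ⊠-assoc (deriv h ⟦ R ⟧) (I b (b ℕ.+ j) ⟦ R ⟧) (∂ 0 R) α ⟨
      (deriv h ⟦ R ⟧ ⊠ I b (b ℕ.+ j) ⟦ R ⟧ ⊠ ∂ 0 R) α
        ≈⟨ ⊠-cong {G = ∂ 0 R} (λ β → trans (⟦⟧-cong R g′≗ β) (⟦⟧-⊛ (deriv h) (I b (b ℕ.+ j)) β)) (λ _ → refl) α ⟨
      (deriv g ⟦ R ⟧ ⊠ ∂ 0 R) α                         ≈⟨ ∂-⟦⟧ 0 g α ⟨
      ∂ 0 (g ⟦ R ⟧) α                                   ∎

    I-index : ∀ {ℓ} → b ≤ ℓ → I b (b ℕ.+ (ℓ ∸ b)) ≗ I b ℓ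
    I-index b≤ℓ n = reflexive (≡.cong (λ m → I b m n) (ℕₚ.m+[n∸m]≡n b≤ℓ))

    -- The induction starts at one derivative: with none, the two sides would differ by the constant
    -- f(0) that `integral` forgets. In the step, the outer derivative commutes past `∂₀^` and meets
    -- a single series in `R`.
    ∂x̂-reduce : ∀ f {k} (ℓs : Vec ℕ (suc k)) → All (b ≤_) ℓs →
      ∂x̂ b ℓs (f ⟦ R ⟧) ≋ ∂₀^ (suc k) (integral (deriv f ⊛ ∏I b ℓs) ⟦ R ⟧)
    ∂x̂-reduce f (ℓ ∷ []) (b≤ℓ ∷ []) = ∂-reduce (ℓ ∸ b) f (integral (deriv f ⊛ ∏I b (ℓ ∷ []))) λ n →
      trans (deriv-integral (deriv f ⊛ ∏I b (ℓ ∷ [])) n) (⊛-cong {deriv f} (λ _ → refl)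
        (λ m → trans (⊛-identityʳ (I b ℓ) m) (sym (I-index b≤ℓ m))) n)
    ∂x̂-reduce f {suc k} (ℓ ∷ ℓs@(_ ∷ _)) (b≤ℓ ∷ b≤ℓs) α = begin
      ∂ (ℓ ∸ b) (∂x̂ b ℓs (f ⟦ R ⟧)) α
        ≈⟨ ∂-cong (ℓ ∸ b) (∂x̂-reduce f ℓs b≤ℓs) α ⟩
      ∂ (ℓ ∸ b) (∂₀^ (suc k) (h ⟦ R ⟧)) α
        ≈⟨ ∂₀^-∂ (suc k) (ℓ ∸ b) (h ⟦ R ⟧) α ⟩
      ∂₀^ (suc k) (∂ (ℓ ∸ b) (h ⟦ R ⟧)) α
        ≈⟨ ∂₀^-cong (suc k) (∂-reduce (ℓ ∸ b) h g g′≗) α ⟩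
      ∂₀^ (suc k) (∂ 0 (g ⟦ R ⟧)) α
        ≈⟨ ∂₀^-suc (suc k) (g ⟦ R ⟧) α ⟩
      ∂₀^ (suc (suc k)) (g ⟦ R ⟧) α ∎
      where
      g h : PowerSeries
      h = integral (deriv f ⊛ ∏I b ℓs)
      g = integral (deriv f ⊛ ∏I b (ℓ ∷ ℓs))

      g′≗ : deriv g ≗ deriv h ⊛ I b (b ℕ.+ (ℓ ∸ b))
      g′≗ n = begin
        deriv g n                                ≈⟨ deriv-integral (deriv f ⊛ ∏I b (ℓ ∷ ℓs)) n ⟩
        (deriv f ⊛ (I b ℓ ⊛ ∏I b ℓs)) n          ≈⟨ ⊛-cong {deriv f} (λ _ → refl) (⊛-comm (I b ℓ) (∏I b ℓs)) n ⟩
        (deriv f ⊛ (∏I b ℓs ⊛ I b ℓ)) n          ≈⟨ ⊛-assoc (deriv f) (∏I b ℓs) (I b ℓ) n ⟨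
        (deriv f ⊛ ∏I b ℓs ⊛ I b ℓ) n
          ≈⟨ ⊛-cong (deriv-integral (deriv f ⊛ ∏I b ℓs)) (I-index b≤ℓ) n ⟨
        (deriv h ⊛ I b (b ℕ.+ (ℓ ∸ b))) n        ∎

    ∂x̂-atOrigin : ∀ f {k} (ℓs : Vec ℕ (suc k)) → All (b ≤_) ℓs →
      atOrigin (∂x̂ b ℓs (f ⟦ R ⟧)) ≈
      (suc k !) · (integral (deriv f ⊛ ∏I b ℓs) ⊚ (λ n → R (n ∷ []))) (suc k)
    ∂x̂-atOrigin f {k} ℓs b≤ℓs = begin
      ∂x̂ b ℓs (f ⟦ R ⟧) []          ≈⟨ ∂x̂-reduce f ℓs b≤ℓs [] ⟩
      ∂₀^ (suc k) (h ⟦ R ⟧) []      ≈⟨ ∂₀^-atOrigin (suc k) (⟦⟧-isMv h isMvSeries) ⟩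
      (suc k !) · (h ⟦ R ⟧) (suc k ∷ []) ≈⟨ ·-congʳ (suc k !) (⟦⟧-restrict h R (suc k)) ⟩
      (suc k !) · (h ⊚ (λ n → R (n ∷ []))) (suc k) ∎
      where
      h : PowerSeries
      h = integral (deriv f ⊛ ∏I b ℓs)

    -- The list `n ∷ []` has length 1, so `∑x` keeps only the term of x̂_b, whose coefficient series
    -- is 1.
    J⊚restriction : J b ⊚ (λ n → R (n ∷ [])) ≗ var
    J⊚restriction n = begin
      (J b ⊚ (λ m → R (m ∷ []))) n                  ≈⟨ ⟦⟧-restrict (J b) R n ⟨
      (J b ⟦ R ⟧) (n ∷ [])                          ≈⟨ equation′ (n ∷ []) ⟩
      (I b (b ℕ.+ 0) ⟦ R ⟧ ⊠ mvVar 0) (n ∷ []) + 0# ≈⟨ +-identityʳ _ ⟩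
      (I b (b ℕ.+ 0) ⟦ R ⟧ ⊠ mvVar 0) (n ∷ [])      ≈⟨ ⊠-cong {G = mvVar 0} I₀⟦R⟧ (λ _ → refl) (n ∷ []) ⟩
      (mvOne ⊠ mvVar 0) (n ∷ [])                    ≈⟨ ⊠-identityˡ (mvVar 0) (n ∷ []) ⟩
      mvVar 0 (n ∷ [])                              ≈⟨ mvVar₀ n ⟩
      var n                                         ∎
      where
      mvVar₀ : ∀ n → mvVar 0 (n ∷ []) ≈ var n
      mvVar₀ zero          = refl
      mvVar₀ (suc zero)    = refl
      mvVar₀ (suc (suc _)) = refl

    restriction-constantTerm : R (0 ∷ []) ≈ 0#
    restriction-constantTerm = trans (isMv-[] isMvSeries) zeroConstantTerm

  -- Agreement of low-order coefficients

  AgreeUpTo : ℕ → PowerSeries → PowerSeries → Set ℓ₁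
  AgreeUpTo n f g = ∀ m → m ≤ n → f m ≈ g m

  agree-mono : ∀ {m n f g} → m ≤ n → AgreeUpTo n f g → AgreeUpTo m f g
  agree-mono m≤n f≈g i i≤m = f≈g i (ℕₚ.≤-trans i≤m m≤n)

  ⊛-agree : ∀ {n f f′ g g′} → AgreeUpTo n f f′ → AgreeUpTo n g g′ → AgreeUpTo n (f ⊛ g) (f′ ⊛ g′)
  ⊛-agree f≈ g≈ m m≤n = ∑-cong (suc m) λ { i (s≤s i≤m) →
    *-cong (f≈ i (ℕₚ.≤-trans i≤m m≤n)) (g≈ (m ∸ i) (ℕₚ.≤-trans (ℕₚ.m∸n≤m m i) m≤n)) }

  pow-agree : ∀ {n f g} → AgreeUpTo n f g → ∀ p → AgreeUpTo n (pow f p) (pow g p)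
  pow-agree f≈g zero    m m≤n = refl
  pow-agree f≈g (suc p) = ⊛-agree f≈g (pow-agree f≈g p)

  ⊚-agree : ∀ {n f f′ g g′} → AgreeUpTo n f f′ → AgreeUpTo n g g′ → AgreeUpTo n (f ⊚ g) (f′ ⊚ g′)
  ⊚-agree f≈ g≈ m m≤n = ∑-cong (suc m) λ { p (s≤s p≤m) →
    *-cong (f≈ p (ℕₚ.≤-trans p≤m m≤n)) (pow-agree g≈ p m m≤n) }

  pow-constantTerm : ∀ {f} → f 0 ≈ 0# → ∀ p → pow f (suc p) 0 ≈ 0#
  pow-constantTerm f₀≈0 p = trans (+-identityʳ _) (trans (*-congʳ f₀≈0) (zeroˡ _))

  -- In a product of at least two factors without constant term, the coefficient of order n + 1 of
  -- one factor can meet only the constant term of the others, which is 0. So coefficients up to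
  -- order n decide, and one order is gained.
  pow-agree-suc : ∀ {n f g} → f 0 ≈ 0# → g 0 ≈ 0# → AgreeUpTo n f g →
    ∀ p → pow f (suc (suc p)) (suc n) ≈ pow g (suc (suc p)) (suc n)
  pow-agree-suc {n} {f} {g} f₀≈0 g₀≈0 f≈g p = +-cong
    (trans (trans (*-congʳ f₀≈0) (zeroˡ _)) (sym (trans (*-congʳ g₀≈0) (zeroˡ _))))
    (∑-cong (suc n) λ { i (s≤s i≤n) → term i i≤n })
    where
    term : ∀ i → i ≤ n → f (suc i) * pow f (suc p) (n ∸ i) ≈ g (suc i) * pow g (suc p) (n ∸ i)
    term i i≤n with ℕₚ.m≤n⇒m<n∨m≡n i≤n
    ... | inj₁ i<n = *-cong (f≈g (suc i) i<n) (pow-agree f≈g (suc p) (n ∸ i) (ℕₚ.m∸n≤m n i))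
    ... | inj₂ ≡.refl = trans (last f f₀≈0) (sym (last g g₀≈0))
      where
      last : ∀ h → h 0 ≈ 0# → h (suc n) * pow h (suc p) (n ∸ n) ≈ 0#
      last h h₀≈0 = trans (*-congˡ (trans (reflexive (≡.cong (pow h (suc p)) (ℕₚ.n∸n≡0 n)))
        (pow-constantTerm h₀≈0 p))) (zeroʳ _)

  -- Compositional inverses

  nonlinear : PowerSeries → PowerSeries
  nonlinear f (suc (suc p)) = f (suc (suc p))
  nonlinear f _             = 0#

  -- If f = r + nonlinear f, its inverse is the fixed point of
  -- σ ↦ z − (nonlinear f)(σ); each iteration settles one more coefficient.
  approxInverse : PowerSeries → ℕ → PowerSeries
  approxInverse f zero    n = 0#
  approxInverse f (suc s) n = var n - (nonlinear f ⊚ approxInverse f s) n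

  approxInverse-0 : ∀ f s → approxInverse f s 0 ≈ 0#
  approxInverse-0 f zero    = refl
  approxInverse-0 f (suc s) =
    trans (+-congˡ (-‿cong (trans (+-identityʳ _) (zeroˡ _)))) (-‿inverseʳ 0#)

  approxInverse-1 : ∀ f s → approxInverse f (suc s) 1 ≈ 1#
  approxInverse-1 f s = trans
    (+-congˡ (-‿cong (trans (+-cong (zeroˡ _) (trans (+-identityʳ _) (zeroˡ _))) (+-identityʳ 0#))))
    (x-0≈x 1#)

  nonlinear-agree : ∀ f {n g h} → g 0 ≈ 0# → h 0 ≈ 0# → AgreeUpTo n g h →
    AgreeUpTo (suc n) (nonlinear f ⊚ g) (nonlinear f ⊚ h)
  nonlinear-agree f g₀≈0 h₀≈0 g≈h zero    _ = refl
  nonlinear-agree f g₀≈0 h₀≈0 g≈h (suc m) (s≤s m≤n) = +-congˡ (+-cong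
    (trans (zeroˡ _) (sym (zeroˡ _)))
    (∑-cong′ m λ p → *-congˡ {f (suc (suc p))} (pow-agree-suc g₀≈0 h₀≈0 (agree-mono m≤n g≈h) p)))

  ⊚-linearPart : ∀ {f g} → f 0 ≈ 0# → f 1 ≈ 1# → g 0 ≈ 0# → ∀ n → (f ⊚ g) n ≈ g n + (nonlinear f ⊚ g) n
  ⊚-linearPart {f} {g} f₀≈0 f₁≈1 g₀≈0 zero =
    trans (+-congʳ (trans (*-congʳ f₀≈0) (sym (+-identityˡ _)))) (trans (+-assoc _ _ _) (+-congʳ (sym g₀≈0)))
  ⊚-linearPart {f} {g} f₀≈0 f₁≈1 g₀≈0 (suc m) = begin
    f 0 * 0# + (f 1 * (g ⊛ one) (suc m) + rest)
      ≈⟨ +-cong (zeroʳ _) (+-congʳ (trans (*-cong f₁≈1 (⊛-identityʳ g (suc m))) (*-identityˡ _))) ⟩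
    0# + (g (suc m) + rest)
      ≈⟨ Solver.solve 3 (λ x y z → con 0 :+ (x :+ y) := x :+ (con 0 :* con 0 :+ (con 0 :* z :+ y))) refl
           (g (suc m)) rest ((g ⊛ one) (suc m)) ⟩
    g (suc m) + (0# * 0# + (0# * (g ⊛ one) (suc m) + rest)) ∎
    where
    open Solver using (_:+_; _:*_; _:=_; con)
    rest : Carrier
    rest = ∑< m λ p → f (suc (suc p)) * pow g (suc (suc p)) (suc m)

  -- `f ⊚ g ≗ var` says that `g` is a fixed point of the iteration, and each iteration gains one
  -- order by `nonlinear-agree`. Every right inverse is thus known to order `s` from the explicit
  -- iterate `s`.
  rightInverse-agree : ∀ {f g} → f 0 ≈ 0# → f 1 ≈ 1# → g 0 ≈ 0# → f ⊚ g ≗ var →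
    ∀ s → AgreeUpTo s g (approxInverse f s)
  rightInverse-agree f₀≈0 f₁≈1 g₀≈0 f⊚g≗var zero    zero    z≤n = g₀≈0
  rightInverse-agree {f} {g} f₀≈0 f₁≈1 g₀≈0 f⊚g≗var (suc s) m m≤ = begin
    g m ≈⟨ +-identityʳ _ ⟨
    g m + 0# ≈⟨ +-congˡ (-‿inverseʳ _) ⟨
    g m + ((nonlinear f ⊚ g) m - (nonlinear f ⊚ g) m) ≈⟨ +-assoc _ _ _ ⟨
    g m + (nonlinear f ⊚ g) m - (nonlinear f ⊚ g) m
      ≈⟨ +-cong (trans (sym (⊚-linearPart f₀≈0 f₁≈1 g₀≈0 m)) (f⊚g≗var m))
                (-‿cong (nonlinear-agree f g₀≈0 (approxInverse-0 f s)
                   (rightInverse-agree f₀≈0 f₁≈1 g₀≈0 f⊚g≗var s) m m≤)) ⟩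
    approxInverse f (suc s) m ∎

  J₁≈1 : ∀ b → J b 1 ≈ 1#
  J₁≈1 b = begin
    ((- 1# * (- 1# * 1#)) * (recip 1 * recip 1)) * 1# ≈⟨ *-identityʳ _ ⟩
    (- 1# * (- 1# * 1#)) * (recip 1 * recip 1)
      ≈⟨ *-cong (trans (*-congˡ (*-identityʳ _)) (trans (-1*x≈-x _) (-‿involutive 1#)))
                (trans (*-cong recip-1 recip-1) (*-identityˡ 1#)) ⟩
    1# * 1# ≈⟨ *-identityˡ 1# ⟩
    1# ∎

  -- Polynomials in one variable

  -- Constant coefficient first. The length `d` bounds the degree, so no coefficient has to be
  -- tested for being zero.
  horner : ∀ {d} → Vec Carrier d → Carrier → Carrier
  horner []       t = 0#
  horner (a ∷ as) t = a + t * horner as t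

  nth : ∀ {d} → Vec Carrier d → ℕ → Carrier
  nth []       _       = 0#
  nth (a ∷ as) zero    = a
  nth (a ∷ as) (suc i) = nth as i

  nth-beyond : ∀ {d} (as : Vec Carrier d) i → d ≤ i → nth as i ≈ 0#
  nth-beyond []       i       _         = refl
  nth-beyond (a ∷ as) (suc i) (s≤s d≤i) = nth-beyond as i d≤i

  horner-at-0 : ∀ {d} (as : Vec Carrier d) → horner as 0# ≈ nth as 0
  horner-at-0 []       = refl
  horner-at-0 (a ∷ as) = trans (+-congˡ (zeroˡ _)) (+-identityʳ a)

  horner-∑ : ∀ {d} N (as : Vec Carrier d) t → d ≤ N → ∑< N (λ i → nth as i * t ^ i) ≈ horner as t
  horner-∑ N       []       t _         = ∑-zero N λ i _ → zeroˡ (t ^ i)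
  horner-∑ (suc N) (a ∷ as) t (s≤s d≤N) = +-cong (*-identityʳ a) (begin
    ∑< N (λ i → nth as i * (t * t ^ i))
      ≈⟨ ∑-cong′ N (λ i → Solver.solve 3 (λ x y z → x :* (y :* z) := y :* (x :* z)) refl (nth as i) t (t ^ i)) ⟩
    ∑< N (λ i → t * (nth as i * t ^ i)) ≈⟨ ∑-distribˡ-* N t (λ i → nth as i * t ^ i) ⟨
    t * ∑< N (λ i → nth as i * t ^ i)   ≈⟨ *-congˡ (horner-∑ N as t d≤N) ⟩
    t * horner as t                     ∎)
    where open Solver using (_:*_; _:=_)

  horner-zipWith-+ : ∀ {d} (as bs : Vec Carrier d) t →
    horner (Vec.zipWith _+_ as bs) t ≈ horner as t + horner bs t
  horner-zipWith-+ []       []       t = sym (+-identityʳ 0#)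
  horner-zipWith-+ (a ∷ as) (b ∷ bs) t = trans (+-congˡ (*-congˡ (horner-zipWith-+ as bs t)))
    (Solver.solve 5 (λ a b t x y → (a :+ b) :+ t :* (x :+ y) := (a :+ t :* x) :+ (b :+ t :* y)) refl
      a b t (horner as t) (horner bs t))
    where open Solver using (_:+_; _:*_; _:=_)

  horner-scale : ∀ {d} x (as : Vec Carrier d) t → horner (Vec.map (x *_) as) t ≈ x * horner as t
  horner-scale x []       t = sym (zeroʳ x)
  horner-scale x (a ∷ as) t = trans (+-congˡ (*-congˡ (horner-scale x as t)))
    (Solver.solve 4 (λ x a t y → x :* a :+ t :* (x :* y) := x :* (a :+ t :* y)) refl x a t (horner as t))
    where open Solver using (_:+_; _:*_; _:=_)

  horner-zeros : ∀ d t → horner (Vec.replicate d 0#) t ≈ 0#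
  horner-zeros zero    t = refl
  horner-zeros (suc d) t = trans (+-identityˡ _) (trans (*-congˡ (horner-zeros d t)) (zeroʳ t))

  horner-padRight : ∀ {d e} (d≤e : d ≤ e) (as : Vec Carrier d) t → horner (Vec.padRight d≤e 0# as) t ≈ horner as t
  horner-padRight {e = e} z≤n [] t = horner-zeros e t
  horner-padRight (s≤s d≤e) (a ∷ as) t = +-congˡ (*-congˡ (horner-padRight d≤e as t))

  polyMul : ∀ {d e} → Vec Carrier d → Vec Carrier e → Vec Carrier (d ℕ.+ e)
  polyMul {e = e}         []       bs = Vec.replicate e 0#
  polyMul {suc d} {e} (a ∷ as) bs =
    Vec.zipWith _+_ (Vec.padRight (ℕₚ.m≤n+m e (suc d)) 0# (Vec.map (a *_) bs)) (0# ∷ polyMul as bs)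

  horner-polyMul : ∀ {d e} (as : Vec Carrier d) (bs : Vec Carrier e) t →
    horner (polyMul as bs) t ≈ horner as t * horner bs t
  horner-polyMul {e = e}     []       bs t = trans (horner-zeros e t) (sym (zeroˡ _))
  horner-polyMul {suc d} {e} (a ∷ as) bs t = begin
    horner (polyMul (a ∷ as) bs) t
      ≈⟨ horner-zipWith-+ (Vec.padRight (ℕₚ.m≤n+m e (suc d)) 0# (Vec.map (a *_) bs)) (0# ∷ polyMul as bs) t ⟩
    horner (Vec.padRight (ℕₚ.m≤n+m e (suc d)) 0# (Vec.map (a *_) bs)) t + (0# + t * horner (polyMul as bs) t)
      ≈⟨ +-cong (trans (horner-padRight (ℕₚ.m≤n+m e (suc d)) (Vec.map (a *_) bs) t) (horner-scale a bs t))
                (+-congˡ (*-congˡ (horner-polyMul as bs t))) ⟩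
    a * horner bs t + (0# + t * (horner as t * horner bs t))
      ≈⟨ Solver.solve 4 (λ a t x y → a :* y :+ (con 0 :+ t :* (x :* y)) := (a :+ t :* x) :* y) refl
           a t (horner as t) (horner bs t) ⟩
    (a + t * horner as t) * horner bs t ∎
    where open Solver using (_:+_; _:*_; _:=_; con)

  -- Synthetic division by t − s.
  quotient : ∀ {d} → Carrier → Vec Carrier (suc d) → Vec Carrier d
  quotient {zero}  s (a ∷ []) = []
  quotient {suc d} s (a ∷ as) = horner as s ∷ quotient s as

  -- The identity P(t) − P(s) = (t − s) Q(t), with both sides moved so that no
  -- subtraction occurs.
  horner-quotient : ∀ {d} s (as : Vec Carrier (suc d)) t →
    horner as t + s * horner (quotient s as) t ≈ horner as s + t * horner (quotient s as) t
  horner-quotient {zero}  s (a ∷ []) t =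
    Solver.solve 3 (λ a s t → (a :+ t :* con 0) :+ s :* con 0 := (a :+ s :* con 0) :+ t :* con 0) refl a s t
    where open Solver using (_:+_; _:*_; _:=_; con)
  horner-quotient {suc d} s (a ∷ as) t = begin
    (a + t * horner as t) + s * (e + t * q)
      ≈⟨ Solver.solve 6 (λ a s t h e q → (a :+ t :* h) :+ s :* (e :+ t :* q) := (a :+ s :* e) :+ t :* (h :+ s :* q))
           refl a s t (horner as t) e q ⟩
    (a + s * e) + t * (horner as t + s * q)
      ≈⟨ +-congˡ (*-congˡ (horner-quotient s as t)) ⟩
    (a + s * e) + t * (e + t * q) ∎
    where
    open Solver using (_:+_; _:*_; _:=_)
    e q : Carrier
    e = horner as s
    q = horner (quotient s as) t

  -- For P = a + t R, the first coefficient of the quotient is R(s). If the quotient is zero, then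
  -- R(s) = 0, hence a = P(s) = 0, and `R` satisfies the same hypotheses.
  quotient-zero : ∀ {d} s (as : Vec Carrier (suc d)) → horner as s ≈ 0# →
    (∀ i → nth (quotient s as) i ≈ 0#) → ∀ i → nth as i ≈ 0#
  quotient-zero {zero}  s (a ∷ []) a≈0 q≈0 zero    = trans (sym (trans (+-congˡ (zeroʳ s)) (+-identityʳ a))) a≈0
  quotient-zero {zero}  s (a ∷ []) a≈0 q≈0 (suc i) = refl
  quotient-zero {suc d} s (a ∷ as) h≈0 q≈0 zero    =
    trans (sym (trans (+-congˡ (trans (*-congˡ (q≈0 0)) (zeroʳ s))) (+-identityʳ a))) h≈0
  quotient-zero {suc d} s (a ∷ as) h≈0 q≈0 (suc i) = quotient-zero s as (q≈0 0) (λ j → q≈0 (suc j)) i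

  -- Divide by t - N. At t = N + m + 1 this divisor is m + 1, which is invertible in characteristic
  -- zero, so the quotient vanishes at all naturals from N + 1 on and has one coefficient fewer.
  horner-zero : ∀ {d} (as : Vec Carrier d) N → (∀ m → horner as (fromℕ (m ℕ.+ N)) ≈ 0#) → ∀ i → nth as i ≈ 0#
  horner-zero []           N h≈0 i = refl
  horner-zero as@(_ ∷ _) N h≈0 = quotient-zero (fromℕ N) as (h≈0 0)
    (horner-zero (quotient (fromℕ N) as) (suc N) q≈0)
    where
    q≈0 : ∀ m → horner (quotient (fromℕ N) as) (fromℕ (m ℕ.+ suc N)) ≈ 0#
    q≈0 m = fromℕ*x≈0⇒x≈0 (suc m) q (+-cancelʳ (fromℕ N * q) _ _ (begin
      fromℕ (suc m) * q + fromℕ N * q   ≈⟨ distribʳ q _ _ ⟨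
      (fromℕ (suc m) + fromℕ N) * q     ≈⟨ *-congʳ (·-homo-+ 1# (suc m) N) ⟨
      fromℕ (suc m ℕ.+ N) * q           ≈⟨ reflexive (≡.cong (λ n → fromℕ n * q) (≡.sym (ℕₚ.+-suc m N))) ⟩
      t * q                             ≈⟨ +-identityˡ _ ⟨
      0# + t * q                        ≈⟨ +-congʳ (h≈0 0) ⟨
      horner as (fromℕ N) + t * q       ≈⟨ horner-quotient (fromℕ N) as t ⟨
      horner as t + fromℕ N * q         ≈⟨ +-congʳ (trans (reflexive (≡.cong (λ n → horner as (fromℕ n)) (ℕₚ.+-suc m N)))
                                             (h≈0 (suc m))) ⟩
      0# + fromℕ N * q ∎))
      where
      t q : Carrier
      t = fromℕ (m ℕ.+ suc N)
      q = horner (quotient (fromℕ N) as) t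

  horner-injective : ∀ {d} (as bs : Vec Carrier d) →
    (∀ n → horner as (fromℕ n) ≈ horner bs (fromℕ n)) → ∀ i → nth as i ≈ nth bs i
  horner-injective as bs as≈bs i = x-y≈0⇒x≈y _ _ (begin
    nth as i - nth bs i                  ≈⟨ +-congˡ (-1*x≈-x _) ⟨
    nth as i + - 1# * nth bs i           ≈⟨ nth-difference as bs i ⟨
    nth (Vec.zipWith _+_ as (Vec.map (- 1# *_) bs)) i
      ≈⟨ horner-zero (Vec.zipWith _+_ as (Vec.map (- 1# *_) bs)) 0 (λ m → difference (m ℕ.+ 0)) i ⟩
    0# ∎)
    where
    nth-difference : ∀ {d} (as bs : Vec Carrier d) i →
      nth (Vec.zipWith _+_ as (Vec.map (- 1# *_) bs)) i ≈ nth as i + - 1# * nth bs i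
    nth-difference []       []       i       = sym (trans (+-identityˡ _) (zeroʳ _))
    nth-difference (a ∷ as) (b ∷ bs) zero    = refl
    nth-difference (a ∷ as) (b ∷ bs) (suc i) = nth-difference as bs i

    difference : ∀ m → horner (Vec.zipWith _+_ as (Vec.map (- 1# *_) bs)) (fromℕ m) ≈ 0#
    difference m = begin
      horner (Vec.zipWith _+_ as (Vec.map (- 1# *_) bs)) (fromℕ m)
        ≈⟨ horner-zipWith-+ as (Vec.map (- 1# *_) bs) (fromℕ m) ⟩
      horner as (fromℕ m) + horner (Vec.map (- 1# *_) bs) (fromℕ m)
        ≈⟨ +-cong (as≈bs m) (trans (horner-scale (- 1#) bs (fromℕ m)) (-1*x≈-x _)) ⟩
      horner bs (fromℕ m) - horner bs (fromℕ m)
        ≈⟨ -‿inverseʳ _ ⟩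
      0# ∎

  -- Families of polynomial functions of b with a common degree bound

  IsPolynomial : ℕ → (ℕ → Carrier) → Set _
  IsPolynomial d F = ∃[ as ] (∀ b → F b ≈ horner {d} as (fromℕ b))

  -- One length `d` serves all `x`: later `x` runs over infinitely many exponent vectors, while
  -- `Polynomial` has a single bound.
  UniformlyPolynomial : {X : Set} → (X → ℕ → Carrier) → Set _
  UniformlyPolynomial F = ∃[ d ] (∀ x → IsPolynomial d (F x))

  module _ {X : Set} where

    poly-cong : {F G : X → ℕ → Carrier} → (∀ x b → F x b ≈ G x b) →
                UniformlyPolynomial F → UniformlyPolynomial G
    poly-cong F≈G (d , F-poly) = d , λ x →
      proj₁ (F-poly x) , λ b → trans (sym (F≈G x b)) (proj₂ (F-poly x) b)

    poly-const : (a : X → Carrier) → UniformlyPolynomial (λ x b → a x)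
    poly-const a = 1 , λ x → (a x ∷ []) , λ b → sym (trans (+-congˡ (zeroʳ _)) (+-identityʳ _))

    poly-b : UniformlyPolynomial {X} (λ x b → fromℕ b)
    poly-b = 2 , λ x → (0# ∷ 1# ∷ []) , λ b →
      Solver.solve 1 (λ t → t := con 0 :+ t :* (con 1 :+ t :* con 0)) refl (fromℕ b)
      where open Solver using (_:+_; _:*_; _:=_; con)

    poly-+ : {F G : X → ℕ → Carrier} → UniformlyPolynomial F → UniformlyPolynomial G →
             UniformlyPolynomial (λ x b → F x b + G x b)
    poly-+ {F} {G} (d , F-poly) (e , G-poly) = d ℕ.+ e , λ x →
      let as , F≈ = F-poly x
          bs , G≈ = G-poly x
          as′ = Vec.padRight (ℕₚ.m≤m+n d e) 0# as
          bs′ = Vec.padRight (ℕₚ.m≤n+m e d) 0# bs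
      in Vec.zipWith _+_ as′ bs′ , λ b → begin
        F x b + G x b                                     ≈⟨ +-cong (F≈ b) (G≈ b) ⟩
        horner as (fromℕ b) + horner bs (fromℕ b)
          ≈⟨ +-cong (horner-padRight (ℕₚ.m≤m+n d e) as _) (horner-padRight (ℕₚ.m≤n+m e d) bs _) ⟨
        horner as′ (fromℕ b) + horner bs′ (fromℕ b)       ≈⟨ horner-zipWith-+ as′ bs′ _ ⟨
        horner (Vec.zipWith _+_ as′ bs′) (fromℕ b)        ∎

    poly-* : {F G : X → ℕ → Carrier} → UniformlyPolynomial F → UniformlyPolynomial G →
             UniformlyPolynomial (λ x b → F x b * G x b)
    poly-* (d , F-poly) (e , G-poly) = d ℕ.+ e , λ x →
      let as , F≈ = F-poly x
          bs , G≈ = G-poly x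
      in polyMul as bs , λ b → trans (*-cong (F≈ b) (G≈ b)) (sym (horner-polyMul as bs _))

    poly-neg : {F : X → ℕ → Carrier} → UniformlyPolynomial F → UniformlyPolynomial (λ x b → - F x b)
    poly-neg F-poly = poly-cong (λ x b → -1*x≈-x _) (poly-* (poly-const λ _ → - 1#) F-poly)

    poly-∑ : ∀ n {F : ℕ → X → ℕ → Carrier} → (∀ i → UniformlyPolynomial (F i)) →
             UniformlyPolynomial (λ x b → ∑< n λ i → F i x b)
    poly-∑ zero    F-poly = poly-const λ _ → 0#
    poly-∑ (suc n) F-poly = poly-+ (F-poly 0) (poly-∑ n λ i → F-poly (suc i))

    poly-∏ : ∀ n {F : ℕ → X → ℕ → Carrier} → (∀ i → UniformlyPolynomial (F i)) →
             UniformlyPolynomial (λ x b → ∏< n λ i → F i x b)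
    poly-∏ zero    F-poly = poly-const λ _ → 1#
    poly-∏ (suc n) F-poly = poly-* (F-poly 0) (poly-∏ n λ i → F-poly (suc i))

    PolynomialCoefficients : (X → ℕ → PowerSeries) → Set _
    PolynomialCoefficients S = ∀ n → UniformlyPolynomial (λ x b → S x b n)

    poly-⊛ : {S T : X → ℕ → PowerSeries} → PolynomialCoefficients S → PolynomialCoefficients T →
             PolynomialCoefficients (λ x b → S x b ⊛ T x b)
    poly-⊛ S-poly T-poly n = poly-∑ (suc n) λ i → poly-* (S-poly i) (T-poly (n ∸ i))

    poly-pow : {S : X → ℕ → PowerSeries} → PolynomialCoefficients S → ∀ p →
               PolynomialCoefficients (λ x b → pow (S x b) p)
    poly-pow S-poly zero    n = poly-const λ _ → one n
    poly-pow S-poly (suc p) = poly-⊛ S-poly (poly-pow S-poly p)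

    poly-⊚ : {S T : X → ℕ → PowerSeries} → PolynomialCoefficients S → PolynomialCoefficients T →
             PolynomialCoefficients (λ x b → S x b ⊚ T x b)
    poly-⊚ S-poly T-poly n = poly-∑ (suc n) λ p → poly-* (S-poly p) (poly-pow T-poly p n)

    poly-integral : {S : X → ℕ → PowerSeries} → PolynomialCoefficients S →
                    PolynomialCoefficients (λ x b → integral (S x b))
    poly-integral S-poly zero    = poly-const λ _ → 0#
    poly-integral S-poly (suc n) = poly-* (poly-const λ _ → recip (suc n)) (S-poly n)

    -- Each coefficient of an iterate comes from coefficients of `S` by finitely many ring
    -- operations. An inverse merely assumed for each b separately would give no such control.
    poly-approxInverse : {S : X → ℕ → PowerSeries} → PolynomialCoefficients S → ∀ s →
                         PolynomialCoefficients (λ x b → approxInverse (S x b) s)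
    poly-approxInverse S-poly zero    n = poly-const λ _ → 0#
    poly-approxInverse {S} S-poly (suc s) n = poly-+ (poly-const λ _ → var n)
      (poly-neg (poly-⊚ nonlinear-poly (poly-approxInverse S-poly s) n))
      where
      nonlinear-poly : PolynomialCoefficients (λ x b → nonlinear (S x b))
      nonlinear-poly zero          = poly-const λ _ → 0#
      nonlinear-poly (suc zero)    = poly-const λ _ → 0#
      nonlinear-poly (suc (suc p)) = S-poly (suc (suc p))

    poly-b-m : ∀ m → UniformlyPolynomial {X} (λ x b → fromℕ b - fromℕ m)
    poly-b-m m = poly-+ poly-b (poly-const λ _ → - fromℕ m)

    poly-J : PolynomialCoefficients (λ x b → J b)
    poly-J zero    = poly-const λ _ → 0#
    poly-J (suc q) = poly-* (poly-const λ _ → (- 1#) ^ suc (suc q) * (1/ suc q ! * 1/ q !))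
      (poly-∏ q λ m → poly-* (poly-b-m m) (poly-+ (poly-b-m m) (poly-const λ _ → - 1#)))

  -- Expansion of I(b,ℓ;r) in powers of ℓ²

  -- An instance of `⊠-agreeBelow` with `mvZero` as the second series, on monomials in x₀ alone.
  ⊛-order : ∀ p q {f g} → (∀ n → n < p → f n ≈ 0#) → (∀ n → n < q → g n ≈ 0#) →
            ∀ n → n < p ℕ.+ q → (f ⊛ g) n ≈ 0#
  ⊛-order p q {f} {g} f-order g-order n n< = trans
    (⊠-agreeBelow p q {inX₀ f} {inX₀ g} {mvZero} (inX₀-order f-order) (inX₀-order g-order) (n ∷ [])
      (≡.subst (_< p ℕ.+ q) (≡.sym (ℕₚ.+-identityʳ n)) n<))
    (proj₂ Mv.zero (inX₀ f) (n ∷ []))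
    where
    inX₀-order : ∀ {p f} → (∀ n → n < p → f n ≈ 0#) → OrderAtLeast p (inX₀ f)
    inX₀-order f-order []      _  = refl
    inX₀-order f-order (n ∷ α) n< = f-order n (ℕₚ.≤-<-trans (ℕₚ.m≤m+n n _) n<)

  ⊛-leading : ∀ {n g} f → (∀ m → m < n → g m ≈ 0#) → (f ⊛ g) n ≈ f 0 * g n
  ⊛-leading {zero}  f g-order = +-identityʳ _
  ⊛-leading {suc n} {g} f g-order = trans
    (+-congˡ (∑-zero (suc n) λ i _ → trans (*-congˡ (g-order (n ∸ i) (s≤s (ℕₚ.m∸n≤m n i)))) (zeroʳ (f (suc i)))))
    (+-identityʳ _)

  pow-order : ∀ {f} → f 0 ≈ 0# → ∀ p n → n < p → pow f p n ≈ 0#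
  pow-order {f} f₀≈0 (suc p) n n< = ⊛-order 1 p {f} (λ { zero _ → f₀≈0 ; (suc _) (s≤s ()) }) (pow-order f₀≈0 p) n n<

  pow-leading : ∀ {f} → f 0 ≈ 0# → f 1 ≈ 1# → ∀ p → pow f p p ≈ 1#
  pow-leading         f₀≈0 f₁≈1 zero    = refl
  pow-leading {f} f₀≈0 f₁≈1 (suc p) = begin
    f 0 * pow f p (suc p) + (tail f ⊛ pow f p) p
      ≈⟨ +-cong (trans (*-congʳ f₀≈0) (zeroˡ _)) (⊛-leading (tail f) (pow-order f₀≈0 p)) ⟩
    0# + f 1 * pow f p p ≈⟨ +-identityˡ _ ⟩
    f 1 * pow f p p      ≈⟨ *-cong f₁≈1 (pow-leading f₀≈0 f₁≈1 p) ⟩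
    1# * 1#              ≈⟨ *-identityˡ 1# ⟩
    1#                   ∎

  -- The coefficient of yᵃ in ∏_{m<p} (y + v m).
  linearFactors : ℕ → (ℕ → Carrier) → ℕ → Carrier
  linearFactors zero    v a = one a
  linearFactors (suc p) v a = v 0 * linearFactors p (λ m → v (suc m)) a + shift (linearFactors p (λ m → v (suc m))) a

  linearFactors-beyond : ∀ p v a → p < a → linearFactors p v a ≈ 0#
  linearFactors-beyond zero    v (suc a) _       = refl
  linearFactors-beyond (suc p) v (suc a) (s≤s p<a) = trans
    (+-cong (trans (*-congˡ (linearFactors-beyond p (λ m → v (suc m)) (suc a) (ℕₚ.m≤n⇒m≤1+n p<a))) (zeroʳ _))
            (linearFactors-beyond p (λ m → v (suc m)) a p<a))
    (+-identityˡ 0#)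

  linearFactors-leading : ∀ p v → linearFactors p v p ≈ 1#
  linearFactors-leading zero    v = refl
  linearFactors-leading (suc p) v = trans
    (+-cong (trans (*-congˡ (linearFactors-beyond p (λ m → v (suc m)) (suc p) ℕₚ.≤-refl)) (zeroʳ _))
            (linearFactors-leading p (λ m → v (suc m))))
    (+-identityˡ 1#)

  linearFactors-∑ : ∀ p v y N → p < N →
    ∑< N (λ a → linearFactors p v a * y ^ a) ≈ ∏< p (λ m → y + v m)
  linearFactors-∑ zero    v y (suc N) _ = trans
    (+-cong (*-identityˡ 1#) (∑-zero N λ a _ → zeroˡ (y ^ suc a))) (+-identityʳ 1#)
  linearFactors-∑ (suc p) v y (suc N) (s≤s p<N) = begin
    ∑< (suc N) (λ a → (v 0 * e a + shift e a) * y ^ a)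
      ≈⟨ ∑-cong′ (suc N) (λ a → trans (distribʳ (y ^ a) (v 0 * e a) (shift e a)) (+-congʳ (*-assoc (v 0) (e a) (y ^ a)))) ⟩
    ∑< (suc N) (λ a → v 0 * (e a * y ^ a) + shift e a * y ^ a)
      ≈⟨ ∑-distrib-+ (suc N) (λ a → v 0 * (e a * y ^ a)) (λ a → shift e a * y ^ a) ⟩
    ∑< (suc N) (λ a → v 0 * (e a * y ^ a)) + (0# * 1# + ∑< N (λ a → e a * (y * y ^ a)))
      ≈⟨ +-cong (sym (∑-distribˡ-* (suc N) (v 0) (λ a → e a * y ^ a)))
                (trans (+-cong (zeroˡ _) (∑-cong′ N λ a →
                   Solver.solve 3 (λ x y z → x :* (y :* z) := y :* (x :* z)) refl (e a) y (y ^ a)))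
                 (trans (+-identityˡ _) (sym (∑-distribˡ-* N y (λ a → e a * y ^ a))))) ⟩
    v 0 * ∑< (suc N) (λ a → e a * y ^ a) + y * ∑< N (λ a → e a * y ^ a)
      -- After the shift the second sum is one term shorter than the first. The polynomial `e` has
      -- degree `p`, which is below both cut-offs.
      ≈⟨ +-cong (*-congˡ (linearFactors-∑ p v′ y (suc N) (ℕₚ.m≤n⇒m≤1+n p<N)))
                (*-congˡ (linearFactors-∑ p v′ y N p<N)) ⟩
    v 0 * Π + y * Π
      ≈⟨ Solver.solve 3 (λ v y z → v :* z :+ y :* z := (y :+ v) :* z) refl (v 0) y Π ⟩
    (y + v 0) * Π ∎
    where
    open Solver using (_:+_; _:*_; _:=_)
    v′ e : ℕ → Carrier
    v′ m = v (suc m)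
    e = linearFactors p v′
    Π : Carrier
    Π = ∏< p (λ m → y + v′ m)

  -- I(b,ℓ;r) = ∑ₐ Icoeff b a ℓ²ᵃ.
  Icoeff : ℕ → ℕ → PowerSeries
  Icoeff b a p = (1/ p ! * 1/ p !) * linearFactors p (λ m → - (fromℕ b - fromℕ m) ^ 2) a

  ∏Icoeff : ∀ {k} → ℕ → Vec ℕ k → PowerSeries
  ∏Icoeff b α = Vec.foldr′ _⊛_ one (Vec.map (Icoeff b) α)

  I-expand : ∀ b ℓ N p → p ≤ N → ∑< (suc N) (λ a → Icoeff b a p * (fromℕ ℓ ^ 2) ^ a) ≈ I b ℓ p
  I-expand b ℓ N p p≤N = begin
    ∑< (suc N) (λ a → (w * e a) * y ^ a) ≈⟨ ∑-cong′ (suc N) (λ a → *-assoc w (e a) (y ^ a)) ⟩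
    ∑< (suc N) (λ a → w * (e a * y ^ a)) ≈⟨ ∑-distribˡ-* (suc N) w (λ a → e a * y ^ a) ⟨
    w * ∑< (suc N) (λ a → e a * y ^ a)   ≈⟨ *-congˡ (linearFactors-∑ p _ y (suc N) (s≤s p≤N)) ⟩
    I b ℓ p ∎
    where
    w y : Carrier
    w = 1/ p ! * 1/ p !
    y = fromℕ ℓ ^ 2
    e : ℕ → Carrier
    e = linearFactors p (λ m → - (fromℕ b - fromℕ m) ^ 2)

  Icoeff-order : ∀ b a n → n < a → Icoeff b a n ≈ 0#
  Icoeff-order b a n n<a = trans (*-congˡ (linearFactors-beyond n _ a n<a)) (zeroʳ _)

  ∏Icoeff-order : ∀ {k} b (α : Vec ℕ k) n → n < Vec.sum α → ∏Icoeff b α n ≈ 0#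
  ∏Icoeff-order b (a ∷ α) = ⊛-order a (Vec.sum α) (Icoeff-order b a) (∏Icoeff-order b α)

  ∏Icoeff-zeros : ∀ b k → ∏Icoeff b (Vec.replicate k 0) 0 ≈ 1#
  ∏Icoeff-zeros b zero    = refl
  ∏Icoeff-zeros b (suc k) = trans (+-identityʳ _)
    (trans (*-cong (trans (*-identityʳ _) (trans (*-cong recip-1 recip-1) (*-identityˡ 1#))) (∏Icoeff-zeros b k))
      (*-identityˡ 1#))

  ∏Icoeff-leading : ∀ b k → ∏Icoeff b (k ∷ Vec.replicate k 0) k ≈ 1/ k ! * 1/ k !
  ∏Icoeff-leading b k = begin
    (Icoeff b k ⊛ zeros) k ≈⟨ ⊛-comm (Icoeff b k) zeros k ⟩
    (zeros ⊛ Icoeff b k) k ≈⟨ ⊛-leading zeros (Icoeff-order b k) ⟩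
    zeros 0 * ((1/ k ! * 1/ k !) * _)
      ≈⟨ *-cong (∏Icoeff-zeros b k) (trans (*-congˡ (linearFactors-leading k _)) (*-identityʳ _)) ⟩
    1# * (1/ k ! * 1/ k !) ≈⟨ *-identityˡ _ ⟩
    1/ k ! * 1/ k !        ∎
    where
    zeros : PowerSeries
    zeros = ∏Icoeff b (Vec.replicate k 0)

  ⊛-commutativeMonoid : CommutativeMonoid c ℓ₁
  ⊛-commutativeMonoid = record
    { Carrier = PowerSeries
    ; _≈_ = _≗_
    ; _∙_ = _⊛_
    ; ε = one
    ; isCommutativeMonoid = record
      { isMonoid = record
        { isSemigroup = record
          { isMagma = record
            { isEquivalence = record
              { refl = λ _ → refl ; sym = λ f≗g n → sym (f≗g n) ; trans = λ f≗g g≗h n → trans (f≗g n) (g≗h n) }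
            ; ∙-cong = ⊛-cong
            }
          ; assoc = ⊛-assoc
          }
        ; identity = ⊛-identityˡ , ⊛-identityʳ
        }
      ; comm = ⊛-comm
      }
    }

  module ⊛-Sum = CommutativeMonoidSum ⊛-commutativeMonoid

  -- `⊛-Sum.sum` is really a product, namely the sum operator of the monoid (`⊛`, `one`). In this
  -- form the invariance of finite sums under permutations applies.
  ∏Icoeff-tabulate : ∀ {k} b (α : Fin k → ℕ) → ∏Icoeff b (Vec.tabulate α) ≗ ⊛-Sum.sum (λ j → Icoeff b (α j))
  ∏Icoeff-tabulate {zero}  b α n = refl
  ∏Icoeff-tabulate {suc k} b α =
    ⊛-cong {Icoeff b (α Fin.zero)} (λ _ → refl) (∏Icoeff-tabulate b λ j → α (Fin.suc j))

  ∏Icoeff-permute : ∀ {k} b (π : Permutation′ k) (α : Vec ℕ k) →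
    ∏Icoeff b (Vec.tabulate (λ j → Vec.lookup α (π ⟨$⟩ʳ j))) ≗ ∏Icoeff b α
  ∏Icoeff-permute b π α n = begin
    ∏Icoeff b (Vec.tabulate (λ j → Vec.lookup α (π ⟨$⟩ʳ j))) n
      ≈⟨ ∏Icoeff-tabulate b (λ j → Vec.lookup α (π ⟨$⟩ʳ j)) n ⟩
    ⊛-Sum.sum (λ j → Icoeff b (Vec.lookup α (π ⟨$⟩ʳ j))) n
      ≈⟨ ⊛-Sum.sum-permute (λ j → Icoeff b (Vec.lookup α j)) π n ⟨
    ⊛-Sum.sum (λ j → Icoeff b (Vec.lookup α j)) n
      ≈⟨ ∏Icoeff-tabulate b (Vec.lookup α) n ⟨
    ∏Icoeff b (Vec.tabulate (Vec.lookup α)) n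
      ≈⟨ reflexive (≡.cong (λ β → ∏Icoeff b β n) (Vecₚ.tabulate∘lookup α)) ⟩
    ∏Icoeff b α n ∎

  poly-reindex : ∀ {X Y : Set} {F : Y → ℕ → Carrier} (g : X → Y) →
    UniformlyPolynomial F → UniformlyPolynomial (λ x → F (g x))
  poly-reindex g (d , F-poly) = d , λ x → F-poly (g x)

  poly-shift : {S : ℕ → PowerSeries} → UniformlyPolynomial (λ a b → S b a) →
               UniformlyPolynomial (λ a b → shift (S b) a)
  poly-shift (d , S-poly) = d , λ
    { zero    → Vec.replicate d 0# , λ b → sym (horner-zeros d (fromℕ b))
    ; (suc a) → S-poly a
    }

  poly-linearFactors : ∀ p {v : ℕ → ℕ → Carrier} → (∀ m → UniformlyPolynomial {ℕ} (λ _ b → v m b)) →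
    UniformlyPolynomial (λ a b → linearFactors p (λ m → v m b) a)
  poly-linearFactors zero    v-poly = poly-const one
  poly-linearFactors (suc p) {v} v-poly = poly-+ (poly-* (v-poly 0) rest)
    (poly-shift {λ b → linearFactors p (λ m → v (suc m) b)} rest)
    where
    rest : UniformlyPolynomial (λ a b → linearFactors p (λ m → v (suc m) b) a)
    rest = poly-linearFactors p (λ m → v-poly (suc m))

  poly-Icoeff : PolynomialCoefficients (λ a b → Icoeff b a)
  poly-Icoeff p = poly-* (poly-const λ _ → 1/ p ! * 1/ p !)
    (poly-linearFactors p λ m → poly-neg (poly-* (poly-b-m m) (poly-* (poly-b-m m) (poly-const λ _ → 1#))))

  poly-∏Icoeff : ∀ k → PolynomialCoefficients {Vec ℕ k} (λ α b → ∏Icoeff b α)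
  poly-∏Icoeff zero    n = poly-cong (λ { [] b → refl }) (poly-const λ _ → one n)
  poly-∏Icoeff (suc k) n = poly-cong (λ { (a ∷ α) b → refl })
    (poly-⊛ {S = λ α b → Icoeff b (Vec.head α)} {T = λ α b → ∏Icoeff b (Vec.tail α)}
      (λ m → poly-reindex Vec.head (poly-Icoeff m)) (λ m → poly-reindex Vec.tail (poly-∏Icoeff k m)) n)

  -- Linear functionals depending on finitely many coefficients

  -- Kept abstract in `L` so that an induction on the number of factors can absorb one factor at a
  -- time: g ↦ L (f ⊛ g) is again of this kind.
  record IsLinearUpTo (N : ℕ) (L : PowerSeries → Carrier) : Set (c ⊔ ℓ₁) where
    field
      cong-upTo : ∀ {g h} → AgreeUpTo N g h → L g ≈ L h
      homo-⊕    : ∀ g h → L (g ⊕ h) ≈ L g + L h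
      homo-*    : ∀ x g → L (λ n → g n * x) ≈ L g * x

    homo-∑ : ∀ n (G : ℕ → PowerSeries) (t : ℕ → Carrier) →
             L (λ m → ∑< n λ i → G i m * t i) ≈ ∑< n λ i → L (G i) * t i
    homo-∑ zero    G t = trans (cong-upTo λ _ _ → sym (zeroˡ 0#)) (trans (homo-* 0# (λ _ → 0#)) (zeroʳ _))
    homo-∑ (suc n) G t = trans (homo-⊕ (λ m → G 0 m * t 0) (λ m → ∑< n λ i → G (suc i) m * t (suc i)))
      (+-cong (homo-* (t 0) (G 0)) (homo-∑ n (λ i → G (suc i)) (λ i → t (suc i))))

  ⊛-distribˡ : ∀ f g h → f ⊛ (g ⊕ h) ≗ f ⊛ g ⊕ f ⊛ h
  ⊛-distribˡ f g h n = trans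
    (∑-cong′ (suc n) λ i → distribˡ (f i) (g (n ∸ i)) (h (n ∸ i)))
    (∑-distrib-+ (suc n) (λ i → f i * g (n ∸ i)) (λ i → f i * h (n ∸ i)))

  ⊛-scaleʳ : ∀ f g x → f ⊛ (λ n → g n * x) ≗ λ n → (f ⊛ g) n * x
  ⊛-scaleʳ f g x n = trans
    (∑-cong′ (suc n) λ i → sym (*-assoc (f i) (g (n ∸ i)) x))
    (sym (∑-distribʳ-* (suc n) x λ i → f i * g (n ∸ i)))

  linear-⊛ : ∀ {N L} f → IsLinearUpTo N L → IsLinearUpTo N (λ g → L (f ⊛ g))
  linear-⊛ f lin = record
    { cong-upTo = λ g≈h → cong-upTo (⊛-agree {f = f} (λ _ _ → refl) g≈h)
    ; homo-⊕ = λ g h → trans (cong-upTo λ m _ → ⊛-distribˡ f g h m) (homo-⊕ (f ⊛ g) (f ⊛ h))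
    ; homo-* = λ x g → trans (cong-upTo λ m _ → ⊛-scaleʳ f g x m) (homo-* x (f ⊛ g))
    }
    where open IsLinearUpTo lin

  linear-integral-⊚ : ∀ k σ → IsLinearUpTo k (λ g → (k !) · (integral g ⊚ σ) k)
  linear-integral-⊚ k σ = record
    { cong-upTo = λ {g} {h} g≈h → ·-congʳ (k !)
        (⊚-agree {k} {integral g} {integral h} {σ} (integral-agree g≈h) (λ _ _ → refl) k ℕₚ.≤-refl)
    ; homo-⊕ = λ g h → trans (·-congʳ (k !) (trans
        (∑-cong′ (suc k) λ p → trans (*-congʳ (integral-⊕ g h p)) (distribʳ (pow σ p k) (integral g p) (integral h p)))
        (∑-distrib-+ (suc k) (λ p → integral g p * pow σ p k) (λ p → integral h p * pow σ p k))))
        (·-distrib-+ _ _ (k !))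
    ; homo-* = λ x g → trans (·-congʳ (k !) (trans
        (∑-cong′ (suc k) λ p → trans (*-congʳ (integral-* x g p))
          (Solver.solve 3 (λ a b c → (a :* b) :* c := (a :* c) :* b) refl (integral g p) x (pow σ p k)))
        (sym (∑-distribʳ-* (suc k) x (λ p → integral g p * pow σ p k)))))
        (sym (·-assoc-* (k !) _ x))
    }
    where
    open Solver using (_:*_; _:=_)
    integral-agree : ∀ {n g h} → AgreeUpTo n g h → AgreeUpTo n (integral g) (integral h)
    integral-agree g≈h zero    _   = refl
    integral-agree g≈h (suc m) m<n = *-congˡ (g≈h m (ℕₚ.<⇒≤ m<n))

    integral-⊕ : ∀ g h → integral (g ⊕ h) ≗ integral g ⊕ integral h
    integral-⊕ g h zero    = sym (+-identityˡ 0#)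
    integral-⊕ g h (suc n) = distribˡ _ _ _

    integral-* : ∀ x g → integral (λ n → g n * x) ≗ λ n → integral g n * x
    integral-* x g zero    = sym (zeroˡ x)
    integral-* x g (suc n) = sym (*-assoc _ _ _)

  linear-weaken : ∀ {M N L} → M ≤ N → IsLinearUpTo M L → IsLinearUpTo N L
  linear-weaken M≤N lin = record
    { cong-upTo = λ g≈h → cong-upTo (agree-mono M≤N g≈h) ; homo-⊕ = homo-⊕ ; homo-* = homo-* }
    where open IsLinearUpTo lin

  evalUpTo-cong : ∀ {n} N {a a′ : Vec ℕ n → Carrier} → (∀ α → a α ≈ a′ α) → ∀ ts →
    evalUpTo N a ts ≈ evalUpTo N a′ ts
  evalUpTo-cong N a≈ []       = a≈ []
  evalUpTo-cong N a≈ (t ∷ ts) = ∑-cong′ (suc N) λ i → *-congʳ {t ^ i} (evalUpTo-cong N (λ α → a≈ (i ∷ α)) ts)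

  evalUpTo-∑ : ∀ {n} N m (a : ℕ → Vec ℕ n → Carrier) (s : ℕ → Carrier) ts →
    ∑< m (λ i → evalUpTo N (a i) ts * s i) ≈ evalUpTo N (λ α → ∑< m λ i → a i α * s i) ts
  evalUpTo-∑ N m a s []       = refl
  evalUpTo-∑ N m a s (t ∷ ts) = begin
    ∑< m (λ i → ∑< (suc N) (λ j → e i j * t ^ j) * s i)
      ≈⟨ ∑-cong′ m (λ i → ∑-distribʳ-* (suc N) (s i) (λ j → e i j * t ^ j)) ⟩
    ∑< m (λ i → ∑< (suc N) (λ j → e i j * t ^ j * s i))
      ≈⟨ ∑-swap m (suc N) (λ i j → e i j * t ^ j * s i) ⟩
    ∑< (suc N) (λ j → ∑< m (λ i → e i j * t ^ j * s i))
      ≈⟨ ∑-cong′ (suc N) (λ j → trans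
           (∑-cong′ m λ i → Solver.solve 3 (λ a b c → (a :* b) :* c := (a :* c) :* b) refl (e i j) (t ^ j) (s i))
           (sym (∑-distribʳ-* m (t ^ j) (λ i → e i j * s i)))) ⟩
    ∑< (suc N) (λ j → ∑< m (λ i → e i j * s i) * t ^ j)
      ≈⟨ ∑-cong′ (suc N) (λ j → *-congʳ {t ^ j} (evalUpTo-∑ N m (λ i α → a i (j ∷ α)) s ts)) ⟩
    ∑< (suc N) (λ j → evalUpTo N (λ α → ∑< m λ i → a i (j ∷ α) * s i) ts * t ^ j) ∎
    where
    open Solver using (_:*_; _:=_)
    e : ℕ → ℕ → Carrier
    e i j = evalUpTo N (λ α → a i (j ∷ α)) ts

  -- The first factor moves into the functional, the induction hypothesis treats the others, and
  -- linearity then sums over the powers of the first ℓ². Cutting the exponents at `N` loses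
  -- nothing, since `L` reads orders up to `N` only and ℓ²ᵃ starts at order a.
  evalUpTo-∏Icoeff : ∀ {k} b N {L} → IsLinearUpTo N L → (ℓs : Vec ℕ k) →
    evalUpTo N (λ α → L (∏Icoeff b α)) (Vec.map (λ ℓ → fromℕ ℓ ^ 2) ℓs) ≈ L (∏I b ℓs)
  evalUpTo-∏Icoeff b N lin []       = refl
  evalUpTo-∏Icoeff b N {L} lin (ℓ ∷ ℓs) = begin
    ∑< (suc N) (λ i → evalUpTo N (λ α → L (Icoeff b i ⊛ ∏Icoeff b α)) ys * y ^ i)
      ≈⟨ ∑-cong′ (suc N) (λ i → *-congʳ {y ^ i} (evalUpTo-∏Icoeff b N (linear-⊛ (Icoeff b i) lin) ℓs)) ⟩
    ∑< (suc N) (λ i → L (Icoeff b i ⊛ ∏I b ℓs) * y ^ i)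
      ≈⟨ homo-∑ (suc N) (λ i → Icoeff b i ⊛ ∏I b ℓs) (λ i → y ^ i) ⟨
    L (λ m → ∑< (suc N) λ i → (Icoeff b i ⊛ ∏I b ℓs) m * y ^ i)
      ≈⟨ cong-upTo collect ⟩
    L (I b ℓ ⊛ ∏I b ℓs) ∎
    where
    open IsLinearUpTo lin
    open Solver using (_:*_; _:=_)
    y : Carrier
    y = fromℕ ℓ ^ 2
    ys : Vec Carrier _
    ys = Vec.map (λ ℓ → fromℕ ℓ ^ 2) ℓs
    g : PowerSeries
    g = ∏I b ℓs

    collect : AgreeUpTo N (λ m → ∑< (suc N) λ i → (Icoeff b i ⊛ g) m * y ^ i) (I b ℓ ⊛ g)
    collect m m≤N = begin
      ∑< (suc N) (λ i → (Icoeff b i ⊛ g) m * y ^ i)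
        ≈⟨ ∑-cong′ (suc N) (λ i → ∑-distribʳ-* (suc m) (y ^ i) (λ j → Icoeff b i j * g (m ∸ j))) ⟩
      ∑< (suc N) (λ i → ∑< (suc m) λ j → Icoeff b i j * g (m ∸ j) * y ^ i)
        ≈⟨ ∑-swap (suc N) (suc m) (λ i j → Icoeff b i j * g (m ∸ j) * y ^ i) ⟩
      ∑< (suc m) (λ j → ∑< (suc N) λ i → Icoeff b i j * g (m ∸ j) * y ^ i)
        ≈⟨ ∑-cong′ (suc m) (λ j → trans
             (∑-cong′ (suc N) λ i → Solver.solve 3 (λ a b c → (a :* b) :* c := (a :* c) :* b) refl
               (Icoeff b i j) (g (m ∸ j)) (y ^ i))
             (sym (∑-distribʳ-* (suc N) (g (m ∸ j)) λ i → Icoeff b i j * y ^ i))) ⟩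
      ∑< (suc m) (λ j → ∑< (suc N) (λ i → Icoeff b i j * y ^ i) * g (m ∸ j))
        ≈⟨ ∑-cong (suc m) (λ { j (s≤s j≤m) → *-congʳ {g (m ∸ j)} (I-expand b ℓ N j (ℕₚ.≤-trans j≤m m≤N)) }) ⟩
      (I b ℓ ⊛ g) m ∎

  -- The polynomial, its symmetry and its degree

  module _ (k : ℕ) (f : PowerSeries) where

    -- The number of derivatives is `suc k` from here on. Iterate `suc k` replaces J⁻¹ and is exact
    -- up to order `suc k`, the order of the coefficient extracted.
    L : ℕ → PowerSeries → Carrier
    L b g = (suc k !) · (integral (deriv f ⊛ g) ⊚ approxInverse (J b) (suc k)) (suc k)

    L-linear : ∀ b → IsLinearUpTo (suc k) (L b)
    L-linear b = linear-⊛ (deriv f) (linear-integral-⊚ (suc k) (approxInverse (J b) (suc k)))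

    L-inverse : ∀ b {σ} → σ 0 ≈ 0# → J b ⊚ σ ≗ var → ∀ g →
      (suc k !) · (integral (deriv f ⊛ g) ⊚ σ) (suc k) ≈ L b g
    L-inverse b {σ} σ₀≈0 J⊚σ≗var g = ·-congʳ (suc k !)
      (⊚-agree {f = integral (deriv f ⊛ g)} (λ _ _ → refl)
        (rightInverse-agree {J b} {σ} refl (J₁≈1 b) σ₀≈0 J⊚σ≗var (suc k)) (suc k) ℕₚ.≤-refl)

    coeffAt : ℕ → Vec ℕ (suc k) → Carrier
    coeffAt b α = L b (∏Icoeff b α)

    abstract
      coeffAt-poly : UniformlyPolynomial (λ α b → coeffAt b α)
      coeffAt-poly = poly-cong (λ α b → sym (·-as-* (suc k !) _))
        (poly-* (poly-const λ _ → fromℕ (suc k !))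
          (poly-⊚ (poly-integral (poly-⊛ (λ n → poly-const λ _ → deriv f n) (poly-∏Icoeff (suc k))))
            (poly-approxInverse poly-J (suc k)) (suc k)))

    -- The product has order at least k + 1, so its integral has order at least k + 2, beyond the
    -- coefficient k + 1 that is extracted. The integral is what brings the degree down to `k`.
    coeffAt-high : ∀ b α → k < Vec.sum α → coeffAt b α ≈ 0#
    coeffAt-high b α k<α = trans (·-congʳ (suc k !) (∑-zero (suc (suc k)) λ p p< →
        trans (*-congʳ (vanish p p<)) (zeroˡ (pow (approxInverse (J b) (suc k)) p (suc k))))) (m·0≈0 (suc k !))
      where
      vanish : ∀ p → p < suc (suc k) → integral (deriv f ⊛ ∏Icoeff b α) p ≈ 0#
      vanish zero    _          = refl
      vanish (suc p) (s≤s p<k) = trans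
        (*-congˡ (⊛-order 0 (Vec.sum α) {deriv f} (λ _ ()) (∏Icoeff-order b α) p (ℕₚ.<-≤-trans p<k k<α)))
        (zeroʳ _)

    leadingExponents : Vec ℕ (suc k)
    leadingExponents = k ∷ Vec.replicate k 0

    leadingExponents-sum : Vec.sum leadingExponents ≡ k
    leadingExponents-sum = ≡.trans (≡.cong (k ℕ.+_) (zeros k)) (ℕₚ.+-identityʳ k)
      where
      zeros : ∀ n → Vec.sum (Vec.replicate n 0) ≡ 0
      zeros zero    = ≡.refl
      zeros (suc n) = zeros n

    -- This is f′(0)/k!, left unsimplified so that apartness from zero follows factor by factor.
    leadingCoeff : Carrier
    leadingCoeff = fromℕ (suc k !) * (recip (suc k) * (deriv f 0 * (1/ k ! * 1/ k !)))

    -- The integral has order at least k + 1, so only the power k + 1 of the inverse contributes,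
    -- with coefficient 1. The linear factors in ℓ² are monic, so b drops out as well.
    coeffAt-leading : ∀ b → coeffAt b leadingExponents ≈ leadingCoeff
    coeffAt-leading b = trans (·-as-* (suc k !) _) (*-congˡ (begin
      (integral (deriv f ⊛ g) ⊚ ρ) (suc k)
        ≈⟨ ∑-snoc (suc k) (λ p → integral (deriv f ⊛ g) p * pow ρ p (suc k)) ⟩
      ∑< (suc k) (λ p → integral (deriv f ⊛ g) p * pow ρ p (suc k)) +
      (recip (suc k) * (deriv f ⊛ g) k) * pow ρ (suc k) (suc k)
        ≈⟨ +-cong (∑-zero (suc k) λ p p< → trans (*-congʳ (vanish p p<)) (zeroˡ (pow ρ p (suc k))))
                  (*-cong (*-congˡ (trans (⊛-leading (deriv f) g-order) (*-congˡ (∏Icoeff-leading b k))))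
                          (pow-leading (approxInverse-0 (J b) (suc k)) (approxInverse-1 (J b) k) (suc k))) ⟩
      0# + (recip (suc k) * (deriv f 0 * (1/ k ! * 1/ k !))) * 1#
        ≈⟨ trans (+-identityˡ _) (*-identityʳ _) ⟩
      recip (suc k) * (deriv f 0 * (1/ k ! * 1/ k !)) ∎))
      where
      g ρ : PowerSeries
      g = ∏Icoeff b leadingExponents
      ρ = approxInverse (J b) (suc k)

      g-order : ∀ n → n < k → g n ≈ 0#
      g-order n n<k = ∏Icoeff-order b leadingExponents n (≡.subst (n <_) (≡.sym leadingExponents-sum) n<k)

      vanish : ∀ p → p < suc k → integral (deriv f ⊛ g) p ≈ 0#
      vanish zero    _         = refl
      vanish (suc p) (s≤s p<k) = trans (*-congˡ (⊛-order 0 k {deriv f} (λ _ ()) g-order p p<k)) (zeroʳ _)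

    leadingCoeff#0 : deriv f 0 # 0# → leadingCoeff # 0#
    leadingCoeff#0 f′₀#0 = x#0y#0→xy#0 (char0 (suc k !) {{(suc k) ℕₚ.!≢0}})
      (x#0y#0→xy#0 (recip#0 (suc k)) (x#0y#0→xy#0 f′₀#0
        (x#0y#0→xy#0 (recip#0 (k !) {{k ℕₚ.!≢0}}) (recip#0 (k !) {{k ℕₚ.!≢0}}))))

    degree : ℕ
    degree = proj₁ coeffAt-poly

    coeffs : Vec ℕ (suc k) → Vec Carrier degree
    coeffs α = proj₁ (proj₂ coeffAt-poly α)

    coeffs-horner : ∀ α b → horner (coeffs α) (fromℕ b) ≈ coeffAt b α
    coeffs-horner α b = sym (proj₂ (proj₂ coeffAt-poly α) b)

    coeffs-unique : ∀ α β → (∀ b → coeffAt b α ≈ coeffAt b β) → ∀ i → nth (coeffs α) i ≈ nth (coeffs β) i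
    coeffs-unique α β eq = horner-injective (coeffs α) (coeffs β) λ b →
      trans (coeffs-horner α b) (trans (eq b) (sym (coeffs-horner β b)))

    coeffs-high : ∀ i α → k < Vec.sum α → nth (coeffs α) i ≈ 0#
    coeffs-high i α k<α = horner-zero (coeffs α) 0
      (λ m → trans (coeffs-horner α (m ℕ.+ 0)) (coeffAt-high (m ℕ.+ 0) α k<α)) i

    -- The constant coefficient in b is the value at b = 0.
    coeffs-leading : nth (coeffs leadingExponents) 0 ≈ leadingCoeff
    coeffs-leading = trans (sym (horner-at-0 (coeffs leadingExponents)))
      (trans (coeffs-horner leadingExponents 0) (coeffAt-leading 0))

    P : Polynomial (suc (suc k))
    P = record
      { coeff   = λ { (i ∷ α) → nth (coeffs α) i }
      -- Beyond this total degree either the exponent of b reaches `degree` or the degree in the ℓᵢ²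
      -- exceeds `k`. As a cut-off for single exponents in `eval` it covers both all powers of b and
      -- all orders read by `L`.
      ; bound   = degree ℕ.+ suc k
      ; bounded = λ { (i ∷ α) → vanish i α }
      }
      where
      vanish : ∀ i α → degree ℕ.+ suc k < i ℕ.+ Vec.sum α → nth (coeffs α) i ≈ 0#
      vanish i α lt with ℕₚ.≤-<-connex degree i
      ... | inj₁ d≤i = nth-beyond (coeffs α) i d≤i
      ... | inj₂ i<d = coeffs-high i α (ℕₚ.<-trans (ℕₚ.n<1+n k) (ℕₚ.≰⇒> λ α≤ →
        ℕₚ.<⇒≱ lt (ℕₚ.+-mono-≤ (ℕₚ.<⇒≤ i<d) α≤)))

    P-symmetric : SymmetricInY P
    P-symmetric π i α = coeffs-unique _ α (λ b → IsLinearUpTo.cong-upTo (L-linear b) λ n _ → ∏Icoeff-permute b π α n) i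

    P-degree : deriv f 0 # 0# → DegreeInY P k
    P-degree f′₀#0 = coeffs-high ,
      0 , leadingExponents , leadingExponents-sum , #-congʳ (sym coeffs-leading) (leadingCoeff#0 f′₀#0)

    P-eval : ∀ b ℓs → L b (∏I b ℓs) ≈ eval P (fromℕ b ∷ Vec.map (λ ℓ → fromℕ ℓ ^ 2) ℓs)
    P-eval b ℓs = sym (begin
      ∑< (suc N) (λ i → evalUpTo N (λ α → nth (coeffs α) i) ys * fromℕ b ^ i)
        ≈⟨ evalUpTo-∑ N (suc N) (λ i α → nth (coeffs α) i) (λ i → fromℕ b ^ i) ys ⟩
      evalUpTo N (λ α → ∑< (suc N) λ i → nth (coeffs α) i * fromℕ b ^ i) ys
        ≈⟨ evalUpTo-cong N (λ α → trans
             (horner-∑ (suc N) (coeffs α) (fromℕ b) (ℕₚ.m≤n⇒m≤1+n (ℕₚ.m≤m+n degree (suc k))))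
             (coeffs-horner α b)) ys ⟩
      evalUpTo N (λ α → L b (∏Icoeff b α)) ys
        ≈⟨ evalUpTo-∏Icoeff b N (linear-weaken (ℕₚ.m≤n+m (suc k) degree) (L-linear b)) ℓs ⟩
      L b (∏I b ℓs) ∎)
      where
      N : ℕ
      N = degree ℕ.+ suc k
      ys : Vec Carrier (suc k)
      ys = Vec.map (λ ℓ → fromℕ ℓ ^ 2) ℓs

lemma13 : ∀ {c ℓ₁ ℓ₂} (K : HeytingField c ℓ₁ ℓ₂) (char0 : CharacteristicZero K) →
    let open Series K char0 in
    (k : ℕ) → 1 ≤ k →
    (f : PowerSeries) → deriv f 0 # 0# →
    ∃[ P ] (SymmetricInY {k} P × DegreeInY P (k ∸ 1) ×
    ((b : ℕ) (ℓs : Vec ℕ k) → All (b ≤_) ℓs →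
    (J⁻¹ : PowerSeries) → IsCompositionalInverse (J b) J⁻¹ →
    ((R̂ : MvSeries) → IsR̂ b R̂ →
    atOrigin (∂x̂ b ℓs (f ⟦ R̂ ⟧))
    ≈ (k !) · (integral (deriv f ⊛ ∏I b ℓs) ⊚ J⁻¹) k) ×
    ((k !) · (integral (deriv f ⊛ ∏I b ℓs) ⊚ J⁻¹) k
    ≈ eval P (fromℕ b ∷ map (λ ℓ → fromℕ ℓ ^ 2) ℓs))))
lemma13 K char0 (suc k) _ f f′₀#0 =
  P k f , P-symmetric k f , P-degree k f f′₀#0 , λ b ℓs b≤ℓs J⁻¹ isInverse →
  let open Series.IsCompositionalInverse isInverse
      integral≈L = L-inverse k f b zeroConstantTerm inverseʳ (Series.∏I K char0 b ℓs)
  -- `R̂` on its axis and `J⁻¹` are both right inverses of `J b`; `L` is the common value through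
  -- which they are compared.
  in (λ R̂ isR̂ → trans (∂x̂-atOrigin isR̂ f ℓs b≤ℓs)
        (trans (L-inverse k f b (restriction-constantTerm isR̂) (J⊚restriction isR̂) (Series.∏I K char0 b ℓs))
               (sym integral≈L)))
   , trans integral≈L (P-eval k f b ℓs)
  where
  open HeytingField K using (trans; sym)
  open Development K char0
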